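{- Let $G=(Y\cup Z,E)$ be a distance-biregular graph with intersection array \[ \begin{vmatrix} k; & c_1^{Y}, & c_2^{Y}, & c_3^{Y}, & c_4^{Y} \\ \ell; & c_1^{Z}, & c_2^{Z}, & c_3^{Z}, & c_4^{Z}\end{vmatrix} \] (so all vertices have eccentricity $4$). Put $b_2^Z=\ell-c_2^Z$ and $b_3^Z=k-c_3^Z$. Suppose that \[ (b_2^{Z}-1)(c_4^{Z}-1)-\frac{b_3^{Z}(c_4^{Z}-1)+c_3^{Z}(b_2^{Z}-1)}{c_2^{Y}}\,(c_2^{Z}-1)=0, \] and let \[ \gamma_3=\frac{c_2^{Y}c_3^{Z}(b_2^{Z}-1)}{b_3^{Z}(c_4^{Z}-1)+c_3^{Z}(b_2^{Z}-1)}. \] If $c_2^Y>\gamma_3$ and $b_3^Z>c_2^Y-\gamma_3$, then for every $z\in Z$ the subgraph of $G$ induced by $N_3(z)\cup N_4(z)$ is distance-biregular with intersection array \[ \begin{vmatrix} b_3^{Z}; & 1, & c_2^{Y}-\gamma_3, & c_3^{Y}, & b_3^{Z} \\ \ell; & 1, & c_2^{Z}, & \frac{(c_2^{Y}-\gamma_3)c_3^{Y}}{c_2^{Z}}, & \ell\end{vmatrix}, \] where the first row refers to the vertices in $N_3(z)\subseteq Y$ and the second to the vertices in $N_4(z)\subseteq Z$.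
   Context: $N_i(a)$ denotes the set of vertices at distance $i$ from $a$. A bipartite graph with bipartition $Y\cup Z$ is distance-biregular if for every vertex $a$, every $i$, and every vertex $w$ at distance $i$ from $a$, the numbers $c_i(a)=|\{u\sim w: d(a,u)=i-1\}|$ and $b_i(a)=|\{u\sim w: d(a,u)=i+1\}|$ depend only on $i$ and on which part contains $a$; these are denoted $c_i^Y,b_i^Y$ or $c_i^Z,b_i^Z$. The intersection array $\begin{vmatrix} k; & c_1^{Y}, & \dots, & c_{d_Y}^{Y} \\ \ell; & c_1^{Z}, & \dots, & c_{d_Z}^{Z}\end{vmatrix}$ records the valency $k$ of vertices in $Y$, the valency $\ell$ of vertices in $Z$, and the $c_i$ values up to the eccentricities $d_Y,d_Z$ of vertices in $Y,Z$. -}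

module Defs where

open import Data.Nat using (ℕ; zero; suc; _<_)
open import Data.Fin using (Fin; toℕ)
open import Data.Bool using (Bool; true; false)
open import Data.List using (List; length)
open import Data.List.Membership.Propositional using (_∈_)
open import Data.List.Relation.Unary.Unique.Propositional using (Unique)
open import Data.Vec using (Vec; lookup)
open import Data.Product using (Σ; ∃; _×_; _,_)
open import Data.Empty using (⊥)
open import Data.Unit using (⊤)
open import Relation.Nullary using (¬_)
open import Relation.Binary.PropositionalEquality using (_≡_; _≢_)
open import Function.Bundles using (_⇔_)
open import Data.Integer using (+_)
open import Data.Rational using (ℚ; _/_; 0ℚ; _÷_; ≢-nonZero)

record Graph : Set₁ where
  field
    n     : ℕ
    Adj   : Fin n → Fin n → Set
    sym   : ∀ {u v} → Adj u v → Adj v u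
    irrefl : ∀ {u} → ¬ Adj u u

open Graph public

Count : ∀ {V : Set} → (V → Set) → ℕ → Set
Count {V} P m = Σ (List V) λ xs → Unique xs × (∀ x → (x ∈ xs) ⇔ P x) × length xs ≡ m

-- Everything below is relative to a vertex set S, i.e. it is about the
-- subgraph of G induced by S.  Taking S = (λ _ → ⊤) gives G itself.

module _ (G : Graph) (S : Fin (n G) → Set) where

  data Walk : Fin (n G) → Fin (n G) → ℕ → Set where
    here : ∀ {a} → S a → Walk a a 0
    step : ∀ {a b c j} → S a → Adj G a b → Walk b c j → Walk a c (suc j)

  Dist : Fin (n G) → Fin (n G) → ℕ → Set
  Dist a u i = Walk a u i × (∀ j → j < i → ¬ Walk a u j)

  -- eccentricity of a in G[S] equals d (in particular G[S] is connected)
  Ecc : Fin (n G) → ℕ → Set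
  Ecc a d = (∀ u → S u → ∃ λ i → i Data.Nat.≤ d × Dist a u i)
          × (∃ λ u → Dist a u d)

  -- G[S] is bipartite with respect to the side function (true = Y, false = Z)
  Bipartite : (Fin (n G) → Bool) → Set
  Bipartite side = ∀ u v → S u → S v → Adj G u v → side u ≢ side v

  -- conditions on a vertex a of one part: valency val, eccentricity d,
  -- and c_i(a) = lookup cs (i-1) for i = 1..d.
  VertexArray : Fin (n G) → (val d : ℕ) → Vec ℕ d → Set
  VertexArray a val d cs =
      Count (λ u → S u × Adj G a u) val
    × Ecc a d
    × (∀ (i : Fin d) w → Dist a w (suc (toℕ i)) →
         Count (λ u → S u × Adj G w u × Dist a u (toℕ i)) (lookup cs i))

  DistanceBiregular : (side : Fin (n G) → Bool)
    (k : ℕ) {dY : ℕ} (cY : Vec ℕ dY) (ℓ : ℕ) {dZ : ℕ} (cZ : Vec ℕ dZ) → Set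
  DistanceBiregular side k {dY} cY ℓ {dZ} cZ =
      Bipartite side
    × (∀ a → S a → side a ≡ true  → VertexArray a k dY cY)
    × (∀ a → S a → side a ≡ false → VertexArray a ℓ dZ cZ)

All : ∀ {m} → Fin m → Set
All _ = ⊤

⟦_⟧ : ℕ → ℚ
⟦ m ⟧ = (+ m) / 1

div : (p q : ℚ) → q ≢ 0ℚ → ℚ
div p q q≢0 = _÷_ p q {{≢-nonZero q≢0}}

{-# OPTIONS --safe #-}
module Submission where

-- Fix z ∈ Z and y ∈ N₃(z).  A vertex y′ ∈ N₃(z) with d(y, y′) = 2 has α common
-- neighbours with y in N₂(z) and β in N₄(z), where α + β = c₂ʸ.  Double counting gives
-- the sums of α, of β and of αβ over all such y′, and the hypothesis says exactly that
-- the variance of α vanishes; so α = γ₃ and β = c₂ʸ − γ₃ =: m for every such pair.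
-- Since m > 0, distances inside N₃(z) ∪ N₄(z) agree with those of G, and the array can
-- be read off.  That vertices of N₃(z) have eccentricity 4 follows from m < b₃ᶻ.  For
-- those of N₄(z) one has to exclude (m c₃ʸ)/c₂ᶻ = b₃ᶻ: two further double counts give
-- ℓ = c₂ᶻ (m + 1), and then equality would make c₂ᶻ divide c₃ʸ < ℓ with quotient at
-- most m, which forces m = 1 and b₃ᶻ = 1, contradicting m < b₃ᶻ.

open import Defs
open import Data.Nat as ℕ using (ℕ; zero; suc; _∸_)
import Data.Nat.Properties as ℕ
open import Data.Nat.Coprimality as Coprime using (1-coprimeTo)
open import Data.Nat.Tactic.RingSolver using (solve-∀)
import Data.Integer as ℤ
import Data.Integer.Properties as ℤ
import Data.Rational as ℚ
import Data.Rational.Properties as ℚ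
open import Data.Rational.Solver using (module +-*-Solver)
open import Data.Fin using (Fin; zero; suc; toℕ)
open import Data.Fin.Patterns using (0F; 1F; 2F; 3F)
import Data.Fin.Properties as Fin
open import Data.Bool using (Bool; true; false; not)
open import Data.Bool.Properties using (¬-not)
open import Data.List using ([]; _∷_; length; filter; tabulate; allFin)
open import Data.List.Membership.Propositional.Properties using (∈-filter⁺; ∈-filter⁻; ∈-allFin)
open import Data.List.Membership.Propositional.Properties.WithK using (unique∧set⇒bag)
open import Data.List.Relation.Binary.BagAndSetEquality using (∼bag⇒↭)
open import Data.List.Relation.Binary.Permutation.Propositional.Properties using (↭-length)
open import Data.List.Relation.Unary.All using ([])
open import Data.List.Relation.Unary.AllPairs using ([]; _∷_)
open import Data.List.Relation.Unary.Any using (here)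
open import Data.List.Relation.Unary.Unique.Propositional.Properties using (filter⁺; allFin⁺)
open import Data.Vec using (_∷_; []; lookup)
open import Data.Product using (∃; ∃₂; _×_; _,_; proj₁; proj₂)
open import Data.Sum using (_⊎_; inj₁; inj₂; [_,_]′)
open import Data.Empty using (⊥; ⊥-elim)
open import Data.Unit using (tt)
open import Function using (_∘_; id; case_of_)
open import Function.Bundles using (mk⇔)
open import Function.Properties.Equivalence using () renaming (sym to ⇔-sym; trans to ⇔-trans)
open import Relation.Nullary using (¬_; Dec; yes; no; ¬?; _×-dec_)
open import Relation.Nullary.Decidable using (map′)
open import Relation.Unary using (Decidable)
open import Relation.Binary using (tri<; tri≈; tri>)
open import Relation.Binary.PropositionalEquality as ≡ using (_≡_; _≢_; refl; cong; cong₂; trans; subst; subst₂; module ≡-Reasoning)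

-- Finite sums, cardinalities of decidable sets and double counting.

module Counting where

  open import Data.Nat using (_+_; _*_; _≤_; _<_; z≤n; s≤s; ∣_-_∣)
  open import Data.Nat.Properties hiding (_≟_)
  open import Algebra.Properties.Semiring.Sum +-*-semiring public using (sum-cong-≗; ∑-distrib-+; ∑-comm; *-distribˡ-sum; *-distribʳ-sum) renaming (sum to ∑)

  ∑-zero⁻ : ∀ {n} (f : Fin n → ℕ) → ∑ f ≡ 0 → ∀ i → f i ≡ 0
  ∑-zero⁻ f eq zero    = m+n≡0⇒m≡0 (f zero) eq
  ∑-zero⁻ f eq (suc i) = ∑-zero⁻ (f ∘ suc) (m+n≡0⇒n≡0 (f zero) eq) i

  ∑-positive⁻ : ∀ {n} (f : Fin n → ℕ) → 0 < ∑ f → ∃ λ i → 0 < f i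
  ∑-positive⁻ {suc n} f pos with f zero in eq
  ... | suc _ = zero , subst (0 <_) (≡.sym eq) (s≤s z≤n)
  ... | zero  = let i , p = ∑-positive⁻ (f ∘ suc) pos in suc i , p

  𝟙 : ∀ {a} {A : Set a} → Dec A → ℕ
  𝟙 (yes _) = 1
  𝟙 (no  _) = 0

  𝟙-cong : ∀ {A B : Set} (A? : Dec A) (B? : Dec B) → (A → B) → (B → A) → 𝟙 A? ≡ 𝟙 B?
  𝟙-cong (yes _) (yes _) _ _ = refl
  𝟙-cong (yes a) (no ¬b) f _ = ⊥-elim (¬b (f a))
  𝟙-cong (no ¬a) (yes b) _ g = ⊥-elim (¬a (g b))
  𝟙-cong (no _)  (no _)  _ _ = refl

  𝟙-× : ∀ {A B : Set} (A? : Dec A) (B? : Dec B) → 𝟙 (A? ×-dec B?) ≡ 𝟙 A? * 𝟙 B?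
  𝟙-× (yes _) (yes _) = refl
  𝟙-× (yes _) (no _)  = refl
  𝟙-× (no _)  _       = refl

  𝟙-⊎ : ∀ {A B C : Set} (A? : Dec A) (B? : Dec B) (C? : Dec C) →
    (A → B ⊎ C) → (B → A) → (C → A) → (B → C → ⊥) → 𝟙 A? ≡ 𝟙 B? + 𝟙 C?
  𝟙-⊎ (yes _) (yes b) (yes c) _ _ _ h = ⊥-elim (h b c)
  𝟙-⊎ (yes _) (yes _) (no _)  _ _ _ _ = refl
  𝟙-⊎ (yes _) (no _)  (yes _) _ _ _ _ = refl
  𝟙-⊎ (yes a) (no ¬b) (no ¬c) f _ _ _ with f a
  ... | inj₁ b = ⊥-elim (¬b b)
  ... | inj₂ c = ⊥-elim (¬c c)
  𝟙-⊎ (no ¬a) (yes b) _       _ g _ _ = ⊥-elim (¬a (g b))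
  𝟙-⊎ (no ¬a) (no _)  (yes c) _ _ g _ = ⊥-elim (¬a (g c))
  𝟙-⊎ (no _)  (no _)  (no _)  _ _ _ _ = refl

  𝟙-*-cong : ∀ {A : Set} (A? : Dec A) {x y : ℕ} → (A → x ≡ y) → 𝟙 A? * x ≡ 𝟙 A? * y
  𝟙-*-cong (yes a) h = cong (1 *_) (h a)
  𝟙-*-cong (no _)  _ = refl

  module _ {n : ℕ} where

    private
      V = Fin n

    abstract
      -- Written as a sum of indicators, so that double counting becomes an interchange of two sums.
      count : {P : V → Set} → Decidable P → ℕ
      count P? = ∑ (λ x → 𝟙 (P? x))

      count-cong : {P Q : V → Set} (P? : Decidable P) (Q? : Decidable Q) →
        (∀ x → P x → Q x) → (∀ x → Q x → P x) → count P? ≡ count Q?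
      count-cong P? Q? f g = sum-cong-≗ (λ x → 𝟙-cong (P? x) (Q? x) (f x) (g x))

      count-⊎ : {P Q R : V → Set} (P? : Decidable P) (Q? : Decidable Q) (R? : Decidable R) →
        (∀ x → P x → Q x ⊎ R x) → (∀ x → Q x → P x) → (∀ x → R x → P x) →
        (∀ x → Q x → R x → ⊥) → count P? ≡ count Q? + count R?
      count-⊎ P? Q? R? f g h e = trans
        (sum-cong-≗ (λ x → 𝟙-⊎ (P? x) (Q? x) (R? x) (f x) (g x) (h x) (e x)))
        (∑-distrib-+ (λ x → 𝟙 (Q? x)) (λ x → 𝟙 (R? x)))

      count-positive⁻ : {P : V → Set} (P? : Decidable P) → 0 < count P? → ∃ P
      count-positive⁻ P? pos with ∑-positive⁻ _ pos
      ... | x , q with P? x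
      ...   | yes p = x , p
      ...   | no _  with () ← q

  length-filter : ∀ {n m} (f : Fin n → Fin m) {P : Fin m → Set} (P? : Decidable P) →
    length (filter P? (tabulate f)) ≡ ∑ (λ x → 𝟙 (P? (f x)))
  length-filter {zero}  f P? = refl
  length-filter {suc n} f P? with P? (f zero)
  ... | yes _ = cong suc (length-filter (f ∘ suc) P?)
  ... | no _  = length-filter (f ∘ suc) P?

  module _ {n : ℕ} where

    abstract
      count⁺ : {P : Fin n → Set} (P? : Decidable P) → Count P (count P?)
      count⁺ P? = filter P? (allFin n)
        , filter⁺ P? (allFin⁺ n)
        , (λ x → mk⇔ (proj₂ ∘ ∈-filter⁻ P? {xs = allFin n}) (∈-filter⁺ P? (∈-allFin x)))
        , length-filter id P?

    -- Duplicate-free lists with the same members are equal as bags, hence permutations of each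
    -- other. This is what turns the entries of the given arrays into values of `count`.
    Count-unique : {P Q : Fin n → Set} {k l : ℕ} →
      (∀ x → P x → Q x) → (∀ x → Q x → P x) → Count P k → Count Q l → k ≡ l
    Count-unique f g (xs , xs! , xs⇔ , refl) (ys , ys! , ys⇔ , refl) =
      ↭-length (∼bag⇒↭ (unique∧set⇒bag xs! ys!
        (λ {x} → ⇔-trans (xs⇔ x) (⇔-trans (mk⇔ (f x) (g x)) (⇔-sym (ys⇔ x))))))

    Count⇒count : {P Q : Fin n → Set} (P? : Decidable P) {k : ℕ} →
      (∀ x → P x → Q x) → (∀ x → Q x → P x) → Count Q k → count P? ≡ k
    Count⇒count P? f g = Count-unique f g (count⁺ P?)

    count⇒Count : {P Q : Fin n → Set} (P? : Decidable P) {k : ℕ} →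
      (∀ x → P x → Q x) → (∀ x → Q x → P x) → count P? ≡ k → Count Q k
    count⇒Count P? f g refl with xs , u , e , l ← count⁺ P? =
      xs , u , (λ x → ⇔-trans (e x) (mk⇔ (f x) (g x))) , l

    count-singleton : (a : Fin n) → count (λ x → x Fin.≟ a) ≡ 1
    count-singleton a = Count-unique (λ _ → id) (λ _ → id) (count⁺ (λ x → x Fin.≟ a))
      (a ∷ [] , ([] ∷ []) , (λ x → mk⇔ (λ { (here refl) → refl }) here) , refl)

    count-remove : {P : Fin n → Set} (P? : Decidable P) {a : Fin n} → P a →
      count P? ≡ suc (count (λ x → P? x ×-dec ¬? (x Fin.≟ a)))
    count-remove {P} P? {a} pa = trans
      (count-⊎ P? (λ x → x Fin.≟ a) (λ x → P? x ×-dec ¬? (x Fin.≟ a)) split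
        (λ { x refl → pa }) (λ x → proj₁) (λ x e q → proj₂ q e))
      (cong (_+ count (λ x → P? x ×-dec ¬? (x Fin.≟ a))) (count-singleton a))
      where
      split : ∀ x → P x → x ≡ a ⊎ (P x × x ≢ a)
      split x px with x Fin.≟ a
      ... | yes e = inj₁ e
      ... | no ne = inj₂ (px , ne)

    count-positive⁺ : {P : Fin n → Set} (P? : Decidable P) {a : Fin n} → P a → 0 < count P?
    count-positive⁺ P? pa = subst (0 <_) (≡.sym (count-remove P? pa)) (s≤s z≤n)

    abstract
      ∑-𝟙-const : {P : Fin n → Set} (P? : Decidable P) (f : Fin n → ℕ) {c : ℕ} →
        (∀ x → P x → f x ≡ c) → ∑ (λ x → 𝟙 (P? x) * f x) ≡ count P? * c
      ∑-𝟙-const P? f {c} h = trans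
        (sum-cong-≗ (λ x → 𝟙-*-cong (P? x) (h x)))
        (≡.sym (*-distribʳ-sum c (λ x → 𝟙 (P? x))))

      -- The weight `g` lets one interchange serve twice: the indicator of `Q` gives `∑-degree`, and
      -- that indicator times a second count gives `∑-codegree`.
      ∑-count-swap : {P : Fin n → Set} {R : Fin n → Fin n → Set}
        (P? : Decidable P) (R? : ∀ x y → Dec (R x y)) (g : Fin n → ℕ) →
        ∑ (λ y → g y * count (λ x → P? x ×-dec R? x y))
          ≡ ∑ (λ x → 𝟙 (P? x) * ∑ (λ y → g y * 𝟙 (R? x y)))
      ∑-count-swap P? R? g = begin
        ∑ (λ y → g y * count (λ x → P? x ×-dec R? x y))
          ≡⟨ sum-cong-≗ (λ y → trans (*-distribˡ-sum (g y) (λ x → 𝟙 (P? x ×-dec R? x y))) (sum-cong-≗ (λ x → exchange x y))) ⟩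
        ∑ (λ y → ∑ (λ x → 𝟙 (P? x) * (g y * 𝟙 (R? x y))))
          ≡⟨ ∑-comm (λ y x → 𝟙 (P? x) * (g y * 𝟙 (R? x y))) ⟩
        ∑ (λ x → ∑ (λ y → 𝟙 (P? x) * (g y * 𝟙 (R? x y))))
          ≡⟨ sum-cong-≗ (λ x → ≡.sym (*-distribˡ-sum (𝟙 (P? x)) (λ y → g y * 𝟙 (R? x y)))) ⟩
        ∑ (λ x → 𝟙 (P? x) * ∑ (λ y → g y * 𝟙 (R? x y))) ∎
        where
        open ≡-Reasoning
        rearrange : ∀ a b c → a * (b * c) ≡ b * (a * c)
        rearrange = solve-∀
        exchange : ∀ x y → g y * 𝟙 (P? x ×-dec R? x y) ≡ 𝟙 (P? x) * (g y * 𝟙 (R? x y))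
        exchange x y = trans (cong (g y *_) (𝟙-× (P? x) (R? x y))) (rearrange (g y) (𝟙 (P? x)) (𝟙 (R? x y)))

      ∑-degree : {P Q : Fin n → Set} {R : Fin n → Fin n → Set}
        (P? : Decidable P) (Q? : Decidable Q) (R? : ∀ x y → Dec (R x y)) {a : ℕ} →
        (∀ x → P x → count (λ y → Q? y ×-dec R? x y) ≡ a) →
        ∑ (λ y → 𝟙 (Q? y) * count (λ x → P? x ×-dec R? x y)) ≡ count P? * a
      ∑-degree P? Q? R? h = trans (∑-count-swap P? R? (λ y → 𝟙 (Q? y)))
        (∑-𝟙-const P? _ (λ x px → trans (sum-cong-≗ (λ y → ≡.sym (𝟙-× (Q? y) (R? x y)))) (h x px)))

    double-counting : {P Q : Fin n → Set} {R : Fin n → Fin n → Set}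
      (P? : Decidable P) (Q? : Decidable Q) (R? : ∀ x y → Dec (R x y)) {a b : ℕ} →
      (∀ x → P x → count (λ y → Q? y ×-dec R? x y) ≡ a) →
      (∀ y → Q y → count (λ x → P? x ×-dec R? x y) ≡ b) →
      count P? * a ≡ count Q? * b
    double-counting P? Q? R? h k = trans (≡.sym (∑-degree P? Q? R? h)) (∑-𝟙-const Q? _ k)

    -- The product of the two counts at y is the number of pairs (x, x′) both related to y. Summing
    -- over x last leaves, for each x, an instance of `∑-degree` on those y in `Q` that are related
    -- to x.
    ∑-codegree : {P P′ Q : Fin n → Set} {R : Fin n → Fin n → Set}
      (P? : Decidable P) (P′? : Decidable P′) (Q? : Decidable Q) (R? : ∀ x y → Dec (R x y)) {a : ℕ} →
      (∀ x x′ → P x → P′ x′ → count (λ y → (Q? y ×-dec R? x y) ×-dec R? x′ y) ≡ a) →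
      ∑ (λ y → 𝟙 (Q? y) * (count (λ x → P? x ×-dec R? x y) * count (λ x → P′? x ×-dec R? x y)))
        ≡ count P? * (count P′? * a)
    ∑-codegree P? P′? Q? R? {a} h = begin
      ∑ (λ y → 𝟙 (Q? y) * (α y * β y))
        ≡⟨ sum-cong-≗ (λ y → rearrange (𝟙 (Q? y)) (α y) (β y)) ⟩
      ∑ (λ y → (𝟙 (Q? y) * β y) * α y)
        ≡⟨ ∑-count-swap P? R? (λ y → 𝟙 (Q? y) * β y) ⟩
      ∑ (λ x → 𝟙 (P? x) * ∑ (λ y → (𝟙 (Q? y) * β y) * 𝟙 (R? x y)))
        ≡⟨ ∑-𝟙-const P? _ inner ⟩
      count P? * (count P′? * a) ∎
      where
      open ≡-Reasoning
      α = λ y → count (λ x → P? x ×-dec R? x y)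
      β = λ y → count (λ x → P′? x ×-dec R? x y)
      rearrange : ∀ a b c → a * (b * c) ≡ (a * c) * b
      rearrange = solve-∀
      rearrange′ : ∀ a b c → (a * b) * c ≡ (a * c) * b
      rearrange′ = solve-∀
      inner : ∀ x → _ → ∑ (λ y → (𝟙 (Q? y) * β y) * 𝟙 (R? x y)) ≡ count P′? * a
      inner x px = trans
        (sum-cong-≗ (λ y → trans (rearrange′ (𝟙 (Q? y)) (β y) (𝟙 (R? x y)))
          (cong (_* β y) (≡.sym (𝟙-× (Q? y) (R? x y))))))
        (∑-degree P′? (λ y → Q? y ×-dec R? x y) R? (λ x′ → h x x′ px))

    count-remove-∸ : {P : Fin n → Set} (P? : Decidable P) {a : Fin n} {c : ℕ} → P a → count P? ≡ c →
      count (λ x → P? x ×-dec ¬? (x Fin.≟ a)) ≡ c ∸ 1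
    count-remove-∸ P? pa e = cong (_∸ 1) (trans (≡.sym (count-remove P? pa)) e)

    count-split : {P R : Fin n → Set} (P? : Decidable P) (R? : Decidable R) →
      count P? ≡ count (λ x → P? x ×-dec R? x) + count (λ x → P? x ×-dec ¬? (R? x))
    count-split {P} {R} P? R? = count-⊎ P? (λ x → P? x ×-dec R? x) (λ x → P? x ×-dec ¬? (R? x)) split
      (λ _ → proj₁) (λ _ → proj₁) (λ _ r s → proj₂ s (proj₂ r))
      where
      split : ∀ x → P x → (P x × R x) ⊎ (P x × ¬ R x)
      split x p with R? x
      ... | yes r = inj₁ (p , r)
      ... | no ¬r = inj₂ (p , ¬r)

    -- The complement of `R` in `P` has positive size. This is how vertices at larger distance are
    -- found from strict inequalities between parameters.
    count-< : {P R : Fin n → Set} (P? : Decidable P) (R? : Decidable R) →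
      count (λ x → P? x ×-dec R? x) < count P? → ∃ λ x → P x × ¬ R x
    count-< P? R? lt with count (λ x → P? x ×-dec ¬? (R? x)) in eq
    ... | suc _ = count-positive⁻ (λ x → P? x ×-dec ¬? (R? x)) (subst (0 <_) (≡.sym eq) (s≤s z≤n))
    ... | zero  = ⊥-elim (<-irrefl (≡.sym (trans (count-split P? R?) (trans (cong (count (λ x → P? x ×-dec R? x) +_) eq) (+-identityʳ _)))) lt)

    ∑-𝟙-positive⁻ : {P : Fin n → Set} (P? : Decidable P) (f : Fin n → ℕ) →
      0 < ∑ (λ x → 𝟙 (P? x) * f x) → ∃ P
    ∑-𝟙-positive⁻ P? f pos with ∑-positive⁻ (λ x → 𝟙 (P? x) * f x) pos
    ... | x , h with P? x
    ...   | yes p = x , p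
    ...   | no _  with () ← h

  -- The expansion of a squared difference, arranged without negative terms so that the variance
  -- argument can stay in ℕ.
  square-difference : ∀ x y → x * x + y * y ≡ 2 * (x * y) + ∣ x - y ∣ * ∣ x - y ∣
  square-difference x y with ≤-total x y
  ... | inj₁ x≤y rewrite m≤n⇒∣m-n∣≡n∸m x≤y = trans (cong (λ w → x * x + w * w) (≡.sym (m+[n∸m]≡n x≤y)))
          (trans (alg x (y ℕ.∸ x)) (cong (λ w → 2 * (x * w) + (y ℕ.∸ x) * (y ℕ.∸ x)) (m+[n∸m]≡n x≤y)))
    where
    alg : ∀ x t → x * x + (x + t) * (x + t) ≡ 2 * (x * (x + t)) + t * t
    alg = solve-∀
  ... | inj₂ y≤x rewrite m≤n⇒∣n-m∣≡n∸m y≤x = trans (cong (λ w → w * w + y * y) (≡.sym (m+[n∸m]≡n y≤x)))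
          (trans (alg y (x ℕ.∸ y)) (cong (λ w → 2 * (w * y) + (x ℕ.∸ y) * (x ℕ.∸ y)) (m+[n∸m]≡n y≤x)))
    where
    alg : ∀ y t → (y + t) * (y + t) + y * y ≡ 2 * ((y + t) * y) + t * t
    alg = solve-∀

  module _ {n : ℕ} where

    ∑-*ˡ : ∀ c (f : Fin n → ℕ) → ∑ (λ x → c * f x) ≡ c * ∑ f
    ∑-*ˡ c f = ≡.sym (*-distribˡ-sum c f)

    -- Σ (Bα − Aβ)² = (A + B)(ABc − (A + B) Σαβ), because Σα² = cA − Σαβ and Σβ² = cB − Σαβ.
    zero-variance : {Q : Fin n → Set} (Q? : Decidable Q) (α β : Fin n → ℕ) {A B c S : ℕ} →
      (∀ y → Q y → α y + β y ≡ c) →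
      ∑ (λ y → 𝟙 (Q? y) * α y) ≡ A →
      ∑ (λ y → 𝟙 (Q? y) * β y) ≡ B →
      ∑ (λ y → 𝟙 (Q? y) * (α y * β y)) ≡ S →
      A * B * c ≡ (A + B) * S →
      ∀ y → Q y → B * α y ≡ A * β y
    zero-variance {Q} Q? α β {A} {B} {c} {S} α+β ΣA ΣB ΣS hyp y qy = ∣m-n∣≡0⇒m≡n sq0
      where
      open ≡-Reasoning
      q = λ y → 𝟙 (Q? y)
      X = λ y → ∣ B * α y - A * β y ∣
      V = ∑ (λ y → q y * (X y * X y))

      -- With a = α and b = β the factor a + b is c, so the left side is linear in α and β. Hence
      -- the three known sums determine the sum of the squared deviations.
      alg : ∀ A B a b X → (B * a) * (B * a) + (A * b) * (A * b) ≡ 2 * ((B * a) * (A * b)) + X →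
        (a + b) * (B * B * a + A * A * b) ≡ (A + B) * (A + B) * (a * b) + X
      alg A B a b X e = begin
        (a + b) * (B * B * a + A * A * b) ≡⟨ l A B a b ⟩
        ((B * a) * (B * a) + (A * b) * (A * b)) + (A * A + B * B) * (a * b) ≡⟨ cong (_+ (A * A + B * B) * (a * b)) e ⟩
        (2 * ((B * a) * (A * b)) + X) + (A * A + B * B) * (a * b) ≡⟨ r A B a b X ⟩
        (A + B) * (A + B) * (a * b) + X ∎
        where
        l : ∀ A B a b → (a + b) * (B * B * a + A * A * b) ≡ ((B * a) * (B * a) + (A * b) * (A * b)) + (A * A + B * B) * (a * b)
        l = solve-∀
        r : ∀ A B a b X → (2 * ((B * a) * (A * b)) + X) + (A * A + B * B) * (a * b) ≡ (A + B) * (A + B) * (a * b) + X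
        r = solve-∀

      pointwise : ∀ y → c * (B * B) * (q y * α y) + c * (A * A) * (q y * β y)
        ≡ (A + B) * (A + B) * (q y * (α y * β y)) + q y * (X y * X y)
      pointwise y = begin
        c * (B * B) * (q y * α y) + c * (A * A) * (q y * β y) ≡⟨ l A B c (q y) (α y) (β y) ⟩
        q y * (c * (B * B * α y + A * A * β y)) ≡⟨ 𝟙-*-cong (Q? y) (λ p → trans (cong (_* (B * B * α y + A * A * β y)) (≡.sym (α+β y p))) (alg A B (α y) (β y) (X y * X y) (square-difference (B * α y) (A * β y)))) ⟩
        q y * ((A + B) * (A + B) * (α y * β y) + X y * X y) ≡⟨ r ((A + B) * (A + B)) (q y) (α y * β y) (X y * X y) ⟩
        (A + B) * (A + B) * (q y * (α y * β y)) + q y * (X y * X y) ∎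
        where
        l : ∀ A B c q a b → c * (B * B) * (q * a) + c * (A * A) * (q * b) ≡ q * (c * (B * B * a + A * A * b))
        l = solve-∀
        r : ∀ K q s x → q * (K * s + x) ≡ K * (q * s) + q * x
        r = solve-∀

      total : c * (B * B) * A + c * (A * A) * B ≡ (A + B) * (A + B) * S + V
      total = begin
        c * (B * B) * A + c * (A * A) * B
          ≡⟨ cong₂ (λ s t → c * (B * B) * s + c * (A * A) * t) (≡.sym ΣA) (≡.sym ΣB) ⟩
        c * (B * B) * ∑ (λ y → q y * α y) + c * (A * A) * ∑ (λ y → q y * β y)
          ≡⟨ cong₂ _+_ (≡.sym (∑-*ˡ (c * (B * B)) _)) (≡.sym (∑-*ˡ (c * (A * A)) _)) ⟩
        ∑ (λ y → c * (B * B) * (q y * α y)) + ∑ (λ y → c * (A * A) * (q y * β y))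
          ≡⟨ ≡.sym (∑-distrib-+ (λ y → c * (B * B) * (q y * α y)) (λ y → c * (A * A) * (q y * β y))) ⟩
        ∑ (λ y → c * (B * B) * (q y * α y) + c * (A * A) * (q y * β y))
          ≡⟨ sum-cong-≗ pointwise ⟩
        ∑ (λ y → (A + B) * (A + B) * (q y * (α y * β y)) + q y * (X y * X y))
          ≡⟨ ∑-distrib-+ (λ y → (A + B) * (A + B) * (q y * (α y * β y))) (λ y → q y * (X y * X y)) ⟩
        ∑ (λ y → (A + B) * (A + B) * (q y * (α y * β y))) + V
          ≡⟨ cong (_+ V) (∑-*ˡ ((A + B) * (A + B)) _) ⟩
        (A + B) * (A + B) * ∑ (λ y → q y * (α y * β y)) + V
          ≡⟨ cong (λ s → (A + B) * (A + B) * s + V) ΣS ⟩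
        (A + B) * (A + B) * S + V ∎

      -- The left side of `total` is (A + B)·ABc, which the hypothesis turns into (A + B)²S, leaving
      -- nothing for `V`.
      V≡0 : V ≡ 0
      V≡0 = +-cancelˡ-≡ ((A + B) * (A + B) * S) V 0 (begin
        (A + B) * (A + B) * S + V ≡⟨ total ⟨
        c * (B * B) * A + c * (A * A) * B ≡⟨ l A B c ⟩
        (A + B) * (A * B * c) ≡⟨ cong ((A + B) *_) hyp ⟩
        (A + B) * ((A + B) * S) ≡⟨ r (A + B) S ⟩
        (A + B) * (A + B) * S + 0 ∎)
        where
        l : ∀ A B c → c * (B * B) * A + c * (A * A) * B ≡ (A + B) * (A * B * c)
        l = solve-∀
        r : ∀ K S → K * (K * S) ≡ K * K * S + 0
        r = solve-∀

      sq0 : X y ≡ 0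
      sq0 with Q? y | ∑-zero⁻ (λ y → q y * (X y * X y)) V≡0 y
      ... | yes _ | e with m*n≡0⇒m≡0∨n≡0 (X y) (trans (≡.sym (*-identityˡ _)) e)
      ...   | inj₁ e′ = e′
      ...   | inj₂ e′ = e′
      sq0 | no ¬q | _ = ⊥-elim (¬q qy)

-- Arithmetic that excludes (m c₃ʸ)/c₂ᶻ = b₃ᶻ.

module ExtremalCase where

  open import Data.Nat using (_+_; _*_; _≤_; _<_; z≤n; s≤s)
  open import Data.Nat.Properties hiding (_≟_)

  -- Here λ = c₂ᶻ, b = b₂ᶻ − 1, r = b₃ᶻ and c = c₃ʸ, and a superscript ⁻ means one less.
  module _ {λ⁻ b m⁻ r⁻ : ℕ}
    (eq₁ : suc r⁻ * λ⁻ ≡ b * suc m⁻)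
    (eq₂ : r⁻ * λ⁻ ≡ (λ⁻ + suc b) * m⁻) where

    -- Subtracting `eq₂` from `eq₁` eliminates r⁻. As ℓ = c₂ᶻ + b₂ᶻ is `suc λ⁻ + suc b`, the result
    -- amounts to ℓ = c₂ᶻ (m + 1).
    1+b≡λm : suc b ≡ suc λ⁻ * suc m⁻
    1+b≡λm = +-cancelʳ-≡ (b * m⁻) _ _ (begin
      suc b + b * m⁻                 ≡⟨ l b m⁻ ⟩
      suc (b * suc m⁻)               ≡⟨ cong suc eq₁ ⟨
      suc (λ⁻ + r⁻ * λ⁻)             ≡⟨ cong (λ t → suc (λ⁻ + t)) eq₂ ⟩
      suc (λ⁻ + (λ⁻ + suc b) * m⁻)   ≡⟨ r λ⁻ b m⁻ ⟩
      suc λ⁻ * suc m⁻ + b * m⁻       ∎)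
      where
      open ≡-Reasoning
      l : ∀ b m → suc b + b * m ≡ suc (b * suc m)
      l = solve-∀
      r : ∀ x b m → suc (x + (x + suc b) * m) ≡ suc x * suc m + b * m
      r = solve-∀

    extremal-impossible : ∀ {c} → suc r⁻ * suc λ⁻ ≡ c * suc m⁻ → c < suc λ⁻ + suc b → suc m⁻ < suc r⁻ → ⊥
    extremal-impossible {c} eq₃ c<ℓ m<r = contradict m⁻≡0
      where
      open ≡-Reasoning
      -- After multiplication by m, `eq₁` trades b m for b₃ᶻ λ⁻, and `eq₃` trades b₃ᶻ c₂ᶻ for c m.
      λb≡cλ⁻ : suc λ⁻ * b ≡ c * λ⁻
      λb≡cλ⁻ = *-cancelʳ-≡ _ _ (suc m⁻) (begin
        suc λ⁻ * b * suc m⁻     ≡⟨ *-assoc (suc λ⁻) b (suc m⁻) ⟩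
        suc λ⁻ * (b * suc m⁻)   ≡⟨ cong (suc λ⁻ *_) eq₁ ⟨
        suc λ⁻ * (suc r⁻ * λ⁻)  ≡⟨ s (suc λ⁻) (suc r⁻) λ⁻ ⟩
        suc r⁻ * suc λ⁻ * λ⁻    ≡⟨ cong (_* λ⁻) eq₃ ⟩
        c * suc m⁻ * λ⁻         ≡⟨ t c (suc m⁻) λ⁻ ⟩
        c * λ⁻ * suc m⁻         ∎)
        where
        s : ∀ a b c → a * (b * c) ≡ b * a * c
        s = solve-∀
        t : ∀ a b c → a * b * c ≡ a * c * b
        t = solve-∀
      -- The quotient c / c₂ᶻ: since c₂ᶻ b = c (c₂ᶻ - 1), the product c₂ᶻ (c - b) is exactly c.
      e = c ∸ b
      λe≡c : suc λ⁻ * e ≡ c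
      λe≡c = begin
        suc λ⁻ * (c ∸ b)              ≡⟨ *-distribˡ-∸ (suc λ⁻) c b ⟩
        suc λ⁻ * c ∸ suc λ⁻ * b       ≡⟨ cong₂ _∸_ (cong (c +_) (*-comm λ⁻ c)) λb≡cλ⁻ ⟩
        c + c * λ⁻ ∸ c * λ⁻           ≡⟨ m+n∸n≡m c (c * λ⁻) ⟩
        c                             ∎
      b≡λ⁻e : b ≡ λ⁻ * e
      b≡λ⁻e = *-cancelˡ-≡ _ _ (suc λ⁻) (trans λb≡cλ⁻ (trans (cong (_* λ⁻) (≡.sym λe≡c)) (s (suc λ⁻) e λ⁻)))
        where
        s : ∀ a e l → a * e * l ≡ a * (l * e)
        s = solve-∀
      -- c₂ᶻ e = c < ℓ = c₂ᶻ (m + 1).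
      e≤m : e ≤ suc m⁻
      e≤m = ≤-pred (*-cancelˡ-< (suc λ⁻) e (suc (suc m⁻))
        (≤-trans (subst (_< suc λ⁻ + suc b) (≡.sym λe≡c) c<ℓ)
          (≤-reflexive (trans (cong (suc λ⁻ +_) 1+b≡λm) (≡.sym (*-suc (suc λ⁻) (suc m⁻)))))))
      -- c₂ᶻ m = 1 + b = 1 + λ⁻ e ≤ 1 + λ⁻ m, and cancelling λ⁻ m leaves m ≤ 1.
      m⁻≡0 : m⁻ ≡ 0
      m⁻≡0 = n≤0⇒n≡0 (≤-pred (+-cancelʳ-≤ (λ⁻ * suc m⁻) (suc m⁻) 1
        (≤-trans (≤-reflexive (≡.sym 1+b≡λm))
          (s≤s (≤-trans (≤-reflexive b≡λ⁻e) (*-monoʳ-≤ λ⁻ e≤m))))))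
      contradict : m⁻ ≡ 0 → ⊥
      -- For m = 1 the right side of `eq₂` is 0. Either r⁻ = 0 and b₃ᶻ = 1, or c₂ᶻ = 1, whence b = 0
      -- and b₃ᶻ = c < ℓ = 2. Both contradict m < b₃ᶻ.
      contradict refl with m*n≡0⇒m≡0∨n≡0 r⁻ (trans eq₂ (*-zeroʳ (λ⁻ + suc b)))
      ... | inj₁ refl = <-irrefl refl m<r
      ... | inj₂ refl = <⇒≱ m<r (≤-pred (subst (suc (suc r⁻) ≤_) (cong suc 1+b≡λm)
            (subst (_< 1 + suc b) (trans (≡.sym (*-identityʳ c)) (trans (≡.sym eq₃) (*-identityʳ (suc r⁻)))) c<ℓ)))

-- Walks and distances in a connected bipartite graph.

module Distances where

  open import Data.Nat using (_+_; _*_; _≤_; _<_; z≤n; s≤s; _≟_)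
  open import Data.Nat.Properties hiding (_≟_)
  open Counting
  open ExtremalCase

  module _ {G : Graph} {S : Fin (n G) → Set} where

    walk-end : ∀ {a b i} → Walk G S a b i → S b
    walk-end (here s)     = s
    walk-end (step _ _ p) = walk-end p

    walk-snoc : ∀ {a b c i} → Walk G S a b i → Adj G b c → S c → Walk G S a c (suc i)
    walk-snoc (here s)     e t = step s e (here t)
    walk-snoc (step s f p) e t = step s f (walk-snoc p e t)

    walk-reverse : ∀ {a b i} → Walk G S a b i → Walk G S b a i
    walk-reverse (here s)     = here s
    walk-reverse (step s e p) = walk-snoc (walk-reverse p) (sym G e) s

    walk-⊤ : ∀ {a b i} → Walk G S a b i → Walk G All a b i
    walk-⊤ (here _)     = here tt
    walk-⊤ (step _ e p) = step tt e (walk-⊤ p)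

  module Metric (G : Graph) (side : Fin (n G) → Bool) (bipartite : Bipartite G All side)
    (diameter : ℕ) (connected : ∀ a u → ∃ λ i → i ≤ diameter × Dist G All a u i) where

    private
      V = Fin (n G)
      variable
        a u v w : V
        i j : ℕ

    abstract
      -- The distance as a function, taken from the eccentricity data. Equality of distances is
      -- thereby decidable, on which the counts below rely.
      d : V → V → ℕ
      d a u = proj₁ (connected a u)

      d-bounded : ∀ a u → d a u ≤ diameter
      d-bounded a u = proj₁ (proj₂ (connected a u))

      walk⇒d≤ : Walk G All a u i → d a u ≤ i
      walk⇒d≤ {a} {u} {i} p with i <? d a u
      ... | yes i<d = ⊥-elim (proj₂ (proj₂ (proj₂ (connected a u))) i i<d p)
      ... | no i≮d  = ≮⇒≥ i≮d

      Dist⇒d : Dist G All a u i → d a u ≡ i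
      Dist⇒d {a} {u} {i} (p , min) with d a u <? i
      ... | yes d<i = ⊥-elim (min _ d<i (proj₁ (proj₂ (proj₂ (connected a u)))))
      ... | no d≮i  = ≤-antisym (walk⇒d≤ p) (≮⇒≥ d≮i)

      d⇒Dist : d a u ≡ i → Dist G All a u i
      d⇒Dist {a} {u} refl = proj₂ (proj₂ (connected a u))

    d-walk : ∀ a u → Walk G All a u (d a u)
    d-walk a u = proj₁ (d⇒Dist refl)

    d-sym : ∀ a u → d a u ≡ d u a
    d-sym a u = ≤-antisym (walk⇒d≤ (walk-reverse (d-walk u a))) (walk⇒d≤ (walk-reverse (d-walk a u)))

    d-refl : ∀ a → d a a ≡ 0
    d-refl a = n≤0⇒n≡0 (walk⇒d≤ (here tt))

    d≡0⇒≡ : d a u ≡ 0 → a ≡ u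
    d≡0⇒≡ {a} {u} e with subst (Walk G All a u) e (d-walk a u)
    ... | here _ = refl

    side-adj : Adj G u v → side v ≡ not (side u)
    side-adj {u} {v} e = ¬-not (bipartite v u tt tt (sym G e))

    -- Each edge flips the side, and the two walks take their steps in parallel. `d-adj` applies
    -- this to walks from one vertex to the two ends of an edge, excluding equal distances.
    side-walk : side a ≡ side w → Walk G All a u i → Walk G All w v i → side u ≡ side v
    side-walk eq (here _) (here _) = eq
    side-walk eq (step _ e p) (step _ f q) =
      side-walk (trans (side-adj e) (trans (cong not eq) (≡.sym (side-adj f)))) p q

    d-adj : Adj G u v → d a v ≡ suc (d a u) ⊎ d a u ≡ suc (d a v)
    d-adj {u} {v} {a} e with <-cmp (d a u) (d a v)
    ... | tri< lt _ _ = inj₁ (≤-antisym (walk⇒d≤ (walk-snoc (d-walk a u) e tt)) lt)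
    ... | tri> _ _ gt = inj₂ (≤-antisym (walk⇒d≤ (walk-snoc (d-walk a v) (sym G e) tt)) gt)
    ... | tri≈ _ eq _ = ⊥-elim (bipartite u v tt tt e
            (side-walk refl (d-walk a u) (subst (Walk G All a v) (≡.sym eq) (d-walk a v))))

    -- The second vertex on a geodesic from w back to a. It is at distance at most i, and not less
    -- because one more edge reaches w.
    predecessor : d a w ≡ suc i → ∃ λ u → Adj G w u × d a u ≡ i
    predecessor {a} {w} {i} e with subst (Walk G All w a) (trans (d-sym w a) e) (d-walk w a)
    ... | step {b = b} _ adj p = b , adj , ≤-antisym b≤i
            (≤-pred (subst (_≤ suc (d a b)) e (walk⇒d≤ (walk-snoc (d-walk a b) (sym G adj) tt))))
      where
      b≤i : d a b ≤ i
      b≤i = subst (_≤ i) (d-sym b a) (walk⇒d≤ p)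

    adj⇒d≡1 : Adj G a u → d a u ≡ 1
    adj⇒d≡1 {a} {u} e with d-adj {a = a} e
    ... | inj₁ eq = trans eq (cong suc (d-refl a))
    ... | inj₂ eq with () ← trans (≡.sym (d-refl a)) eq

    d≡1⇒adj : d a u ≡ 1 → Adj G a u
    d≡1⇒adj {a} e with predecessor e
    ... | x , adj , eq with refl ← d≡0⇒≡ eq = sym G adj

    path⇒d≡2 : u ≢ v → Adj G u w → Adj G w v → d u v ≡ 2
    path⇒d≡2 {u} u≢v e f with d-adj {a = u} f
    ... | inj₁ eq = trans eq (cong suc (adj⇒d≡1 e))
    ... | inj₂ eq = ⊥-elim (u≢v (d≡0⇒≡ (≡.sym (suc-injective (trans (≡.sym (adj⇒d≡1 e)) eq)))))

    d-adj-from : Adj G u v → d a u ≡ suc i → d a v ≡ suc (suc i) ⊎ d a v ≡ i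
    d-adj-from {a = a} e eq with d-adj {a = a} e
    ... | inj₁ p = inj₁ (trans p (cong suc eq))
    ... | inj₂ p = inj₂ (suc-injective (trans (≡.sym p) eq))

  flips : ℕ → Bool → Bool
  flips zero    b = b
  flips (suc i) b = not (flips i b)

  -- Intersection numbers as cardinalities.

  module Array (G : Graph) (side : Fin (n G) → Bool)
    (k ℓ c1Y c2Y c3Y c4Y c1Z c2Z c3Z c4Z : ℕ)
    (dbr : DistanceBiregular G All side k (c1Y ∷ c2Y ∷ c3Y ∷ c4Y ∷ []) ℓ (c1Z ∷ c2Z ∷ c3Z ∷ c4Z ∷ []))
    where

    private
      V = Fin (n G)
      rowY = proj₁ (proj₂ dbr)
      rowZ = proj₂ (proj₂ dbr)
      variable
        a u v w x y y′ w′ : V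
        i : ℕ

    ecc : ∀ a → Ecc G All a 4
    ecc a with side a in eq
    ... | true  = proj₁ (proj₂ (rowY a tt eq))
    ... | false = proj₁ (proj₂ (rowZ a tt eq))

    open Metric G side (proj₁ dbr) 4 (λ a u → proj₁ (ecc a) u tt) public

    antipode : ∀ a → ∃ λ u → d a u ≡ 4
    antipode a = proj₁ (proj₂ (ecc a)) , Dist⇒d (proj₂ (proj₂ (ecc a)))

    abstract
      -- `Adj` is a bare relation; it is decided through d(a, u) = 1.
      adj? : ∀ a u → Dec (Adj G a u)
      adj? a u = map′ d≡1⇒adj adj⇒d≡1 (d a u ≟ 1)

    -- Sides alternate along a geodesic. For a literal `i` the term `flips i b` computes, so that a
    -- wrong parity is refuted by pattern matching.
    side-d : ∀ i {b} → side a ≡ b → d a u ≡ i → side u ≡ flips i b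
    side-d zero    s e = trans (cong side (≡.sym (d≡0⇒≡ e))) s
    side-d (suc i) s e with predecessor e
    ... | v , adj , e′ = trans (side-adj (sym G adj)) (cong not (side-d i s e′))

    valencyY : side a ≡ true → count (adj? a) ≡ k
    valencyY {a} s = Count⇒count (adj? a) (λ _ e → tt , e) (λ _ → proj₂) (proj₁ (rowY a tt s))

    valencyZ : side a ≡ false → count (adj? a) ≡ ℓ
    valencyZ {a} s = Count⇒count (adj? a) (λ _ e → tt , e) (λ _ → proj₂) (proj₁ (rowZ a tt s))

    countY : side a ≡ true → (i : Fin 4) → d a w ≡ suc (toℕ i) →
      count (λ u → adj? w u ×-dec (d a u ≟ toℕ i)) ≡ lookup (c1Y ∷ c2Y ∷ c3Y ∷ c4Y ∷ []) i
    countY {a} {w} s i e = Count⇒count (λ u → adj? w u ×-dec (d a u ≟ toℕ i))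
      (λ u (f , h) → tt , f , d⇒Dist h) (λ u (_ , f , h) → f , Dist⇒d h)
      (proj₂ (proj₂ (rowY a tt s)) i w (d⇒Dist e))

    countZ : side a ≡ false → (i : Fin 4) → d a w ≡ suc (toℕ i) →
      count (λ u → adj? w u ×-dec (d a u ≟ toℕ i)) ≡ lookup (c1Z ∷ c2Z ∷ c3Z ∷ c4Z ∷ []) i
    countZ {a} {w} s i e = Count⇒count (λ u → adj? w u ×-dec (d a u ≟ toℕ i))
      (λ u (f , h) → tt , f , d⇒Dist h) (λ u (_ , f , h) → f , Dist⇒d h)
      (proj₂ (proj₂ (rowZ a tt s)) i w (d⇒Dist e))

    commonY : side x ≡ true → d x y ≡ 2 → count (λ u → adj? x u ×-dec adj? y u) ≡ c2Y
    commonY {x} {y} s e = trans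
      (count-cong (λ u → adj? x u ×-dec adj? y u) (λ u → adj? y u ×-dec (d x u ≟ 1))
        (λ _ (f , g) → g , adj⇒d≡1 f) (λ _ (g , h) → d≡1⇒adj h , g))
      (countY s 1F e)

    commonZ : side x ≡ false → d x y ≡ 2 → count (λ u → adj? x u ×-dec adj? y u) ≡ c2Z
    commonZ {x} {y} s e = trans
      (count-cong (λ u → adj? x u ×-dec adj? y u) (λ u → adj? y u ×-dec (d x u ≟ 1))
        (λ _ (f , g) → g , adj⇒d≡1 f) (λ _ (g , h) → d≡1⇒adj h , g))
      (countZ s 1F e)

    -- By parity no neighbour of w is as far from a as w is. The second summand counts the
    -- neighbours one step farther, so each such number is a valency minus the corresponding c.
    valency-split : ∀ a {w i} → d a w ≡ suc i →
      count (adj? w) ≡ count (λ u → adj? w u ×-dec (d a u ≟ i)) + count (λ u → adj? w u ×-dec (d a u ≟ suc (suc i)))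
    valency-split a {w} {i} e = count-⊎ (adj? w) _ _ split (λ _ → proj₁) (λ _ → proj₁)
      (λ _ (_ , p) (_ , q) → <⇒≢ (m<n⇒m<1+n (n<1+n i)) (trans (≡.sym p) q))
      where
      split : ∀ u → Adj G w u → (Adj G w u × d a u ≡ i) ⊎ (Adj G w u × d a u ≡ suc (suc i))
      split u f with d-adj-from {a = a} f e
      ... | inj₁ h = inj₂ (f , h)
      ... | inj₂ h = inj₁ (f , h)

    d≢5 : d a u ≢ 5
    d≢5 {a} {u} e = <⇒≱ (n<1+n 4) (subst (_≤ 4) e (d-bounded a u))

    d≡4⇒adj-d≡3 : d a w ≡ 4 → Adj G w u → d a u ≡ 3
    d≡4⇒adj-d≡3 {a} e f with d-adj-from {a = a} f e
    ... | inj₁ h = ⊥-elim (d≢5 h)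
    ... | inj₂ h = h

    -- Counting between the distance classes N₂(z), N₃(z) and N₄(z).

    module Local (z : V) (side-z : side z ≡ false) where

      N : ℕ → V → Set
      N i u = d z u ≡ i

      N? : ∀ i → Decidable (N i)
      N? i u = d z u ≟ i

      -- A superscript ⁻ marks a parameter lowered by one; b2 is ℓ ∸ c2Z.
      b3 b2⁻ ℓ⁻ c2Z⁻ : ℕ
      b3   = k ∸ c3Z
      b2⁻  = ℓ ∸ c2Z ∸ 1
      ℓ⁻   = ℓ ∸ 1
      c2Z⁻ = c2Z ∸ 1

      side2 : N 2 u → side u ≡ false
      side2 = side-d 2 side-z
      side3 : N 3 u → side u ≡ true
      side3 = side-d 3 side-z
      side4 : N 4 u → side u ≡ false
      side4 = side-d 4 side-z

      abstract
        -- The end of one geodesic from z to a vertex at distance 4. These vertices witness that the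
        -- truncated subtractions in `b3`, `b2⁻`, `ℓ⁻` and `c2Z⁻` are exact.
        w₄ y₃ u₂ : V
        w₄ = proj₁ (antipode z)
        y₃ = proj₁ (predecessor (proj₂ (antipode z)))
        w₄∈N4 : N 4 w₄
        w₄∈N4 = proj₂ (antipode z)
        w₄~y₃ : Adj G w₄ y₃
        w₄~y₃ = proj₁ (proj₂ (predecessor (proj₂ (antipode z))))
        y₃∈N3 : N 3 y₃
        y₃∈N3 = proj₂ (proj₂ (predecessor (proj₂ (antipode z))))
        u₂ = proj₁ (predecessor y₃∈N3)
        y₃~u₂ : Adj G y₃ u₂
        y₃~u₂ = proj₁ (proj₂ (predecessor y₃∈N3))
        u₂∈N2 : N 2 u₂
        u₂∈N2 = proj₂ (proj₂ (predecessor y₃∈N3))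

      -- Nothing lies beyond distance 4, so every neighbour of `w₄` is in N₃(z).
      c4Z≡ℓ : c4Z ≡ ℓ
      c4Z≡ℓ = trans (≡.sym (countZ side-z 3F w₄∈N4)) (trans
        (count-cong (λ u → adj? w₄ u ×-dec N? 3 u) (adj? w₄) (λ _ → proj₁) (λ _ f → f , d≡4⇒adj-d≡3 w₄∈N4 f))
        (valencyZ (side4 w₄∈N4)))

      k-split : N 3 y → k ≡ c3Z + count (λ w → adj? y w ×-dec N? 4 w)
      k-split {y} h = trans (≡.sym (valencyY (side3 h)))
        (trans (valency-split z h) (cong (_+ count (λ w → adj? y w ×-dec N? 4 w)) (countZ side-z 2F h)))

      ℓ-split : N 2 u → ℓ ≡ c2Z + count (λ y → adj? u y ×-dec N? 3 y)
      ℓ-split {u} h = trans (≡.sym (valencyZ (side2 h)))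
        (trans (valency-split z h) (cong (_+ count (λ y → adj? u y ×-dec N? 3 y)) (countZ side-z 1F h)))

      up3 : N 3 y → count (λ w → adj? y w ×-dec N? 4 w) ≡ b3
      up3 {y} h = trans (≡.sym (m+n∸m≡n c3Z _)) (cong (_∸ c3Z) (≡.sym (k-split h)))

      up2 : N 2 u → count (λ y → adj? u y ×-dec N? 3 y) ≡ ℓ ∸ c2Z
      up2 {u} h = trans (≡.sym (m+n∸m≡n c2Z _)) (cong (_∸ c2Z) (≡.sym (ℓ-split h)))

      down3 : N 3 y → count (λ u → adj? y u ×-dec N? 2 u) ≡ c3Z
      down3 h = countZ side-z 2F h

      k≡c3Z+b3 : k ≡ c3Z + b3
      k≡c3Z+b3 = trans (k-split y₃∈N3) (cong (c3Z +_) (up3 y₃∈N3))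

      ℓ≡c2Z+1+b2⁻ : ℓ ≡ c2Z + suc b2⁻
      ℓ≡c2Z+1+b2⁻ = trans (ℓ-split u₂∈N2) (cong (c2Z +_) (trans
        (count-remove (λ y → adj? u₂ y ×-dec N? 3 y) (sym G y₃~u₂ , y₃∈N3))
        (cong suc (count-remove-∸ (λ y → adj? u₂ y ×-dec N? 3 y) (sym G y₃~u₂ , y₃∈N3) (up2 u₂∈N2)))))

      ℓ≡1+ℓ⁻ : ℓ ≡ suc ℓ⁻
      ℓ≡1+ℓ⁻ = trans (≡.sym (valencyZ (side4 w₄∈N4))) (trans (count-remove (adj? w₄) w₄~y₃)
        (cong suc (count-remove-∸ (adj? w₄) w₄~y₃ (valencyZ (side4 w₄∈N4)))))

      N2≢N4 : N 2 u → N 4 w → u ≢ w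
      N2≢N4 p q refl with () ← trans (≡.sym p) q

      d-u₂w₄ : d u₂ w₄ ≡ 2
      d-u₂w₄ = path⇒d≡2 (N2≢N4 u₂∈N2 w₄∈N4) (sym G y₃~u₂) (sym G w₄~y₃)

      c2Z≡1+c2Z⁻ : c2Z ≡ suc c2Z⁻
      c2Z≡1+c2Z⁻ = trans (≡.sym (commonZ (side2 u₂∈N2) d-u₂w₄)) (trans
        (count-remove (λ y → adj? u₂ y ×-dec adj? w₄ y) (sym G y₃~u₂ , w₄~y₃))
        (cong suc (count-remove-∸ (λ y → adj? u₂ y ×-dec adj? w₄ y) (sym G y₃~u₂ , w₄~y₃)
          (commonZ (side2 u₂∈N2) d-u₂w₄))))

      N4-adj : N 4 w → Adj G w y → N 3 y
      N4-adj = d≡4⇒adj-d≡3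

      Near : V → V → Set
      Near y y′ = N 3 y′ × d y y′ ≡ 2

      Near? : ∀ y → Decidable (Near y)
      Near? y y′ = N? 3 y′ ×-dec (d y y′ ≟ 2)

      -- The conditions are nested so that the set independent of `y′` comes first, the shape on
      -- which `∑-degree` and `∑-codegree` operate.
      α β : V → V → ℕ
      α y y′ = count (λ u → (adj? y u ×-dec N? 2 u) ×-dec adj? u y′)
      β y y′ = count (λ w → (adj? y w ×-dec N? 4 w) ×-dec adj? w y′)

      d≡2⇒≢ : d y y′ ≡ 2 → y′ ≢ y
      d≡2⇒≢ {y} e refl with () ← trans (≡.sym (d-refl y)) e

      α+β≡c2Y : N 3 y → Near y y′ → α y y′ + β y y′ ≡ c2Y
      α+β≡c2Y {y} {y′} h (h′ , e) = trans (≡.sym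
        (count-⊎ (λ u → adj? y u ×-dec adj? y′ u) _ _ split
          (λ _ ((f , _) , g) → f , sym G g) (λ _ ((f , _) , g) → f , sym G g)
          (λ _ ((_ , p) , _) ((_ , q) , _) → N2≢N4 p q refl)))
        (commonY (side3 h) e)
        where
        split : ∀ u → Adj G y u × Adj G y′ u →
          ((Adj G y u × N 2 u) × Adj G u y′) ⊎ ((Adj G y u × N 4 u) × Adj G u y′)
        split u (f , g) with d-adj-from {a = z} f h
        ... | inj₁ q = inj₂ ((f , q) , sym G g)
        ... | inj₂ q = inj₁ ((f , q) , sym G g)

      -- Each neighbour of u in N₃(z) other than y is joined to y through u, hence at distance 2.
      -- Leaving out y lowers the count by one; so it does in the next two lemmas, where all
      -- neighbours of w lie in N₃(z).
      near-from-N2 : Adj G y u → N 3 y → N 2 u → count (λ y′ → Near? y y′ ×-dec adj? u y′) ≡ b2⁻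
      near-from-N2 {y} {u} f h h′ = trans
        (count-cong (λ y′ → Near? y y′ ×-dec adj? u y′) (λ y′ → (adj? u y′ ×-dec N? 3 y′) ×-dec ¬? (y′ Fin.≟ y))
          (λ _ ((p , e) , g) → (g , p) , d≡2⇒≢ e)
          (λ _ ((g , p) , ne) → (p , path⇒d≡2 (ne ∘ ≡.sym) f g) , g))
        (count-remove-∸ (λ y′ → adj? u y′ ×-dec N? 3 y′) (sym G f , h) (up2 h′))

      near-from-N4 : Adj G y w → N 4 w → count (λ y′ → Near? y y′ ×-dec adj? w y′) ≡ ℓ⁻
      near-from-N4 {y} {w} f h = trans
        (count-cong (λ y′ → Near? y y′ ×-dec adj? w y′) (λ y′ → adj? w y′ ×-dec ¬? (y′ Fin.≟ y))
          (λ _ ((p , e) , g) → g , d≡2⇒≢ e)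
          (λ _ (g , ne) → (N4-adj h g , path⇒d≡2 (ne ∘ ≡.sym) f g) , g))
        (count-remove-∸ (adj? w) (sym G f) (valencyZ (side4 h)))

      near-from-both : Adj G y u → Adj G y w → u ≢ w → N 4 w →
        count (λ y′ → (Near? y y′ ×-dec adj? u y′) ×-dec adj? w y′) ≡ c2Z⁻
      near-from-both {y} {u} {w} f g u≢w h = trans
        (count-cong (λ y′ → (Near? y y′ ×-dec adj? u y′) ×-dec adj? w y′)
          (λ y′ → (adj? w y′ ×-dec adj? u y′) ×-dec ¬? (y′ Fin.≟ y))
          (λ _ (((p , e) , g₁) , g₂) → (g₂ , g₁) , d≡2⇒≢ e)
          (λ _ ((g₂ , g₁) , ne) → ((N4-adj h g₂ , path⇒d≡2 (ne ∘ ≡.sym) f g₁) , g₁) , g₂))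
        (count-remove-∸ (λ y′ → adj? w y′ ×-dec adj? u y′) (sym G g , sym G f)
          (commonZ (side4 h) (path⇒d≡2 (u≢w ∘ ≡.sym) (sym G g) f)))

      -- The totals of α and of β over all y′ near a given y. Their sum is the denominator of γ₃.
      A B : ℕ
      A = c3Z * b2⁻
      B = b3 * ℓ⁻

      ∑α : N 3 y → ∑ (λ y′ → 𝟙 (Near? y y′) * α y y′) ≡ A
      ∑α {y} h = trans
        (∑-degree (λ u → adj? y u ×-dec N? 2 u) (Near? y) adj? (λ u (f , p) → near-from-N2 f h p))
        (cong (_* b2⁻) (down3 h))

      ∑β : N 3 y → ∑ (λ y′ → 𝟙 (Near? y y′) * β y y′) ≡ B
      ∑β {y} h = trans
        (∑-degree (λ w → adj? y w ×-dec N? 4 w) (Near? y) adj? (λ w (f , p) → near-from-N4 f p))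
        (cong (_* ℓ⁻) (up3 h))

      -- A neighbour of y in N₂(z) and one in N₄(z) have c₂ᶻ common neighbours, one of which is y
      -- itself.
      ∑αβ : N 3 y → ∑ (λ y′ → 𝟙 (Near? y y′) * (α y y′ * β y y′)) ≡ c3Z * (b3 * c2Z⁻)
      ∑αβ {y} h = trans
        (∑-codegree (λ u → adj? y u ×-dec N? 2 u) (λ w → adj? y w ×-dec N? 4 w) (Near? y) adj?
          (λ u w (f , p) (g , q) → near-from-both f g (N2≢N4 p q) q))
        (cong₂ (λ s t → s * (t * c2Z⁻)) (down3 h) (up3 h))

      -- One of the totals `A`, `B` is nonzero, so the sum that it evaluates has a term.
      near-exists : 0 < A + B → N 3 y → ∃ (Near y)
      near-exists {y} pos h with A in eqA
      ... | suc _ = ∑-𝟙-positive⁻ (Near? y) (α y) (subst (0 <_) (≡.sym (trans (∑α h) eqA)) (s≤s z≤n))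
      ... | zero  = ∑-𝟙-positive⁻ (Near? y) (β y) (subst (0 <_) (≡.sym (∑β h)) pos)

      module _ (equality : b2⁻ * ℓ⁻ * c2Y ≡ (A + B) * c2Z⁻) where

        -- `equality` is the hypothesis on the array with its denominator cleared. Multiplied by
        -- `c3Z * b3` it becomes the condition A B c₂ʸ = (A + B) ∑αβ of `zero-variance`.
        balance : N 3 y → Near y y′ → B * α y y′ ≡ A * β y y′
        balance {y} {y′} h = zero-variance (Near? y) (α y) (β y) (λ y′ → α+β≡c2Y h) (∑α h) (∑β h) (∑αβ h)
          (trans (l c3Z b2⁻ b3 ℓ⁻ c2Y) (trans (cong (c3Z * b3 *_) equality) (r (c3Z) b3 (A + B) c2Z⁻))) y′
          where
          l : ∀ c b b′ e f → (c * b) * (b′ * e) * f ≡ c * b′ * (b * e * f)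
          l = solve-∀
          r : ∀ c b D e → c * b * (D * e) ≡ D * (c * (b * e))
          r = solve-∀

        -- The equation α = γ₃ before division by A + B.
        α-value : N 3 y → Near y y′ → (A + B) * α y y′ ≡ A * c2Y
        α-value {y} {y′} h h′ = begin
          (A + B) * α y y′          ≡⟨ *-distribʳ-+ (α y y′) A B ⟩
          A * α y y′ + B * α y y′   ≡⟨ cong (A * α y y′ +_) (balance h h′) ⟩
          A * α y y′ + A * β y y′   ≡⟨ *-distribˡ-+ A (α y y′) (β y y′) ⟨
          A * (α y y′ + β y y′)     ≡⟨ cong (A *_) (α+β≡c2Y h h′) ⟩
          A * c2Y                   ∎
          where open ≡-Reasoning

        -- `A` and `B` do not depend on the base vertex, so neither does α, and β is its complement
        -- in c₂ʸ.
        β-constant : 0 < A + B → ∀ {x x′} → N 3 y → Near y y′ → N 3 x → Near x x′ → β x x′ ≡ β y y′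
        β-constant {y} {y′} pos {x} {x′} h h′ g g′ = +-cancelˡ-≡ (α x x′) _ _ (begin
          α x x′ + β x x′ ≡⟨ α+β≡c2Y g g′ ⟩
          c2Y             ≡⟨ α+β≡c2Y h h′ ⟨
          α y y′ + β y y′ ≡⟨ cong (_+ β y y′) (*-cancelˡ-≡ _ _ (A + B) {{ℕ.>-nonZero pos}} (trans (α-value h h′) (≡.sym (α-value g g′)))) ⟩
          α x x′ + β y y′ ∎)
          where open ≡-Reasoning

      -- The subgraph induced by N₃(z) ∪ N₄(z).

      module Subgraph (m : ℕ) (0<m : 0 < m) (m<b3 : m < b3)
        (β≡m : ∀ {y y′} → N 3 y → Near y y′ → β y y′ ≡ m)
        (near : ∀ {y} → N 3 y → ∃ (Near y)) where

        S : V → Set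
        S u = Dist G All z u 3 ⊎ Dist G All z u 4

        N3⇒S : N 3 u → S u
        N3⇒S = inj₁ ∘ d⇒Dist

        N4⇒S : N 4 u → S u
        N4⇒S = inj₂ ∘ d⇒Dist

        S-true : S u → side u ≡ true → N 3 u
        S-true (inj₁ p) s = Dist⇒d p
        S-true (inj₂ p) s = case trans (≡.sym s) (side4 (Dist⇒d p)) of λ ()

        S-false : S u → side u ≡ false → N 4 u
        S-false (inj₂ p) s = Dist⇒d p
        S-false (inj₁ p) s = case trans (≡.sym s) (side3 (Dist⇒d p)) of λ ()

        N3-adj : N 3 y → Adj G y w → S w → N 4 w
        N3-adj h f s = S-false s (trans (side-adj f) (cong not (side3 h)))

        upward : N 3 y → ∃ λ w → Adj G y w × N 4 w
        upward {y} h = count-positive⁻ (λ w → adj? y w ×-dec N? 4 w) (subst (0 <_) (≡.sym (up3 h)) (≤-trans 0<m (<⇒≤ m<b3)))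

        link : N 3 y → Near y y′ → ∃ λ w → (Adj G y w × N 4 w) × Adj G w y′
        link {y} {y′} h h′ = count-positive⁻ (λ w → (adj? y w ×-dec N? 4 w) ×-dec adj? w y′) (subst (0 <_) (≡.sym (β≡m h h′)) 0<m)

        -- This makes distances in the subgraph agree with those of G, by building a geodesic inside
        -- `S` one vertex at a time. For u in N₄(z) every neighbour is in `S`; for u in N₃(z) parity
        -- leaves the distances 2 and 4 or 1 and 3.
        S-predecessor : S a → S u → d a u ≡ suc i → ∃ λ v → S v × Adj G u v × d a v ≡ i
        S-predecessor sa (inj₂ p) e =
          let v , f , e′ = predecessor e in v , N3⇒S (N4-adj (Dist⇒d p) f) , f , e′
        S-predecessor {a} {u} {i} (inj₁ q) (inj₁ p) e = cases i e
          where
          a∈N3 = Dist⇒d q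
          u∈N3 = Dist⇒d p
          parity : ∀ j → d a u ≡ j → true ≡ flips j true
          parity j e = trans (≡.sym (side3 u∈N3)) (side-d j (side3 a∈N3) e)
          cases : ∀ i → d a u ≡ suc i → ∃ λ v → S v × Adj G u v × d a v ≡ i
          cases 0 e = case parity 1 e of λ ()
          -- Positivity of β supplies a common neighbour inside N₄(z).
          cases 1 e = let w , (f , h) , g = link a∈N3 (u∈N3 , e) in w , N4⇒S h , sym G g , adj⇒d≡1 f
          cases 2 e = case parity 3 e of λ ()
          -- Any neighbour of u in N₄(z) works, since distance 5 does not occur.
          cases 3 e = let w , f , h = upward u∈N3 in w , N4⇒S h , f , d≡4⇒adj-d≡3 e f
          cases (suc (suc (suc (suc i)))) e = ⊥-elim (<⇒≱ (m≤m+n 5 i) (subst (_≤ 4) e (d-bounded a u)))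
        S-predecessor {a} {u} {i} (inj₂ q) (inj₁ p) e = cases i e
          where
          a∈N4 = Dist⇒d q
          u∈N3 = Dist⇒d p
          parity : ∀ j → d a u ≡ j → true ≡ flips j false
          parity j e = trans (≡.sym (side3 u∈N3)) (side-d j (side4 a∈N4) e)
          cases : ∀ i → d a u ≡ suc i → ∃ λ v → S v × Adj G u v × d a v ≡ i
          cases 0 e = a , N4⇒S a∈N4 , sym G (d≡1⇒adj e) , d-refl a
          cases 1 e = case parity 2 e of λ ()
          -- A neighbour y′ of a at distance 2 from u lies in N₃(z), so u and y′ have a common
          -- neighbour w in N₄(z). It differs from a, which is not adjacent to u, so d(a, w) = 2
          -- through y′.
          cases 2 e =
            let y′ , f , e′ = predecessor (trans (d-sym u a) e)
                w , (g , h) , g′ = link u∈N3 (N4-adj a∈N4 f , e′)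
                a≢w = λ a≡w → case trans (≡.sym e) (adj⇒d≡1 (subst (λ x → Adj G x u) (≡.sym a≡w) (sym G g))) of λ ()
            in w , N4⇒S h , g , path⇒d≡2 a≢w f (sym G g′)
          cases 3 e = case parity 4 e of λ ()
          cases (suc (suc (suc (suc i)))) e = ⊥-elim (<⇒≱ (m≤m+n 5 i) (subst (_≤ 4) e (d-bounded a u)))

        S-walk : ∀ i → S a → S u → d a u ≡ i → Walk G S a u i
        S-walk {a} zero    sa su e = subst (λ u → Walk G S a u 0) (d≡0⇒≡ e) (here sa)
        S-walk     (suc i) sa su e =
          let v , sv , f , e′ = S-predecessor sa su e in walk-snoc (S-walk i sa sv e′) (sym G f) su

        d⇒S-Dist : S a → S u → d a u ≡ i → Dist G S a u i
        d⇒S-Dist {i = i} sa su e = S-walk i sa su e ,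
          λ j j<i p → <⇒≱ j<i (subst (_≤ j) e (walk⇒d≤ (walk-⊤ p)))

        S-Dist⇒d : Dist G S a u i → S u × d a u ≡ i
        S-Dist⇒d (p , min) = walk-end p , ≤-antisym (walk⇒d≤ (walk-⊤ p))
          (≮⇒≥ λ d<i → min _ d<i (S-walk _ (walk-end (walk-reverse p)) (walk-end p) refl))

        -- On a geodesic from `y₃` to a vertex at distance 4, the vertex at distance 3 has valency ℓ
        -- and at least one neighbour farther out.
        c3Y<ℓ : c3Y < ℓ
        c3Y<ℓ =
          let v , e = antipode y₃
              w , f , e′ = predecessor e
              far? = λ u → adj? w u ×-dec (d y₃ u ≟ 4)
          in subst (c3Y <_)
               (trans (cong (_+ count far?) (≡.sym (countY (side3 y₃∈N3) 2F e′)))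
                 (trans (≡.sym (valency-split y₃ e′)) (valencyZ (side-d 3 (side3 y₃∈N3) e′))))
               (m<m+n c3Y (count-positive⁺ far? (sym G f , e)))

        -- For y′ near y only m < b₃ᶻ of the neighbours of y′ in N₄(z) are adjacent to y; any other
        -- one is at distance 3 from y.
        at-distance-3 : N 3 y → ∃ λ w → N 4 w × d y w ≡ 3
        at-distance-3 {y} h =
          let y′ , (h′ , e) = near h
              β<b3 = subst₂ _<_ (≡.sym (β≡m h′ (h , trans (d-sym y′ y) e))) (≡.sym (up3 h′)) m<b3
              w , (f , g) , ¬f = count-< (λ w → adj? y′ w ×-dec N? 4 w) (λ w → adj? w y) β<b3
          in w , g , [ id , (λ e′ → ⊥-elim (¬f (sym G (d≡1⇒adj e′)))) ]′ (d-adj-from f e)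

        -- A vertex w of N₄(z) at distance 3 from y has a neighbour not at distance 2 from y,
        -- because c₃ʸ < ℓ. It is at distance 4, and in N₃(z) like all neighbours of w.
        antipode-N3 : N 3 y → ∃ λ y′ → N 3 y′ × d y y′ ≡ 4
        antipode-N3 {y} h =
          let w , h′ , e = at-distance-3 h
              c<ℓ = subst₂ _<_ (≡.sym (countY (side3 h) 2F e)) (≡.sym (valencyZ (side4 h′))) c3Y<ℓ
              y′ , f , ne = count-< (adj? w) (λ u → d y u ≟ 2) c<ℓ
          in y′ , N4-adj h′ f , [ id , ⊥-elim ∘ ne ]′ (d-adj-from f e)

        N4-at-distance-3 : N 4 w → ∃ λ y → N 3 y × d w y ≡ 3
        N4-at-distance-3 {w} h =
          let y , f , h′ = predecessor h
              y′ , h″ , e = antipode-N3 h′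
          in y′ , h″ , trans (d-sym w y′) (d≡4⇒adj-d≡3 (trans (d-sym y′ y) e) (sym G f))

        -- For d(w, y) = 3 this becomes the entry c₃ of w in the subgraph.
        ρ : V → V → ℕ
        ρ w y = count (λ w′ → (adj? y w′ ×-dec N? 4 w′) ×-dec (d w w′ ≟ 2))

        -- Count the edges between the c₃ʸ neighbours of w at distance 2 from y and the vertices
        -- counted by `ρ`. The former have m such edges each, the latter c₂ᶻ.
        ρ-value : N 4 w → N 3 y → d w y ≡ 3 → ρ w y * c2Z ≡ c3Y * m
        ρ-value {w} {y} h h′ e = trans (≡.sym (double-counting
          (λ y′ → adj? w y′ ×-dec (d y y′ ≟ 2))
          (λ w′ → (adj? y w′ ×-dec N? 4 w′) ×-dec (d w w′ ≟ 2)) (λ y′ w′ → adj? w′ y′) rows columns))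
          (cong (_* m) (countY (side3 h′) 2F (trans (d-sym y w) e)))
          where
          -- Rules out w′ = w in the rows and y′ = y in the columns.
          ¬adj : ¬ Adj G w y
          ¬adj f = case trans (≡.sym e) (adj⇒d≡1 f) of λ ()
          rows : ∀ y′ → Adj G w y′ × d y y′ ≡ 2 →
            count (λ w′ → ((adj? y w′ ×-dec N? 4 w′) ×-dec (d w w′ ≟ 2)) ×-dec adj? w′ y′) ≡ m
          rows y′ (f , e′) = trans
            (count-cong _ (λ w′ → (adj? y w′ ×-dec N? 4 w′) ×-dec adj? w′ y′)
              (λ _ ((p , _) , g) → p , g)
              (λ _ (p , g) → (p , path⇒d≡2 (λ { refl → ¬adj (sym G (proj₁ p)) }) f (sym G g)) , g))
            (β≡m h′ (N4-adj h f , e′))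
          columns : ∀ w′ → (Adj G y w′ × N 4 w′) × d w w′ ≡ 2 →
            count (λ y′ → (adj? w y′ ×-dec (d y y′ ≟ 2)) ×-dec adj? w′ y′) ≡ c2Z
          columns w′ ((f , p) , e′) = trans
            (count-cong _ (λ y′ → adj? w y′ ×-dec adj? w′ y′)
              (λ _ ((g , _) , g′) → g , g′)
              (λ y′ (g , g′) → (g , path⇒d≡2 (λ { refl → ¬adj g }) f g′) , g′))
            (commonZ (side4 h) e′)

        -- Count the edges between the neighbours of `y₃` in N₄(z) and the vertices near `y₃` that
        -- are adjacent to `u₂`. This supplies `eq₁` of the extremal case.
        b3*c2Z⁻≡b2⁻*m : b3 * c2Z⁻ ≡ b2⁻ * m
        b3*c2Z⁻≡b2⁻*m = begin
          b3 * c2Z⁻ ≡⟨ cong (_* c2Z⁻) (up3 y₃∈N3) ⟨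
          count (λ w → adj? y₃ w ×-dec N? 4 w) * c2Z⁻
            ≡⟨ double-counting (λ w → adj? y₃ w ×-dec N? 4 w) (λ y′ → Near? y₃ y′ ×-dec adj? u₂ y′) adj?
                 (λ w (f , h) → near-from-both y₃~u₂ f (N2≢N4 u₂∈N2 h) h) (λ y′ (h , _) → β≡m y₃∈N3 h) ⟩
          count (λ y′ → Near? y₃ y′ ×-dec adj? u₂ y′) * m
            ≡⟨ cong (_* m) (near-from-N2 y₃~u₂ y₃∈N3 u₂∈N2) ⟩
          b2⁻ * m ∎
          where open ≡-Reasoning

        -- The same count with `w₄` in the place of `u₂`. Now `w₄` itself is excluded from the
        -- neighbours of `y₃`, which lowers b₃ᶻ and m by one. This supplies `eq₂`.
        b3⁻*c2Z⁻≡ℓ⁻*m⁻ : (b3 ∸ 1) * c2Z⁻ ≡ ℓ⁻ * (m ∸ 1)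
        b3⁻*c2Z⁻≡ℓ⁻*m⁻ = begin
          (b3 ∸ 1) * c2Z⁻
            ≡⟨ cong (_* c2Z⁻) (count-remove-∸ (λ w → adj? y₃ w ×-dec N? 4 w) (sym G w₄~y₃ , w₄∈N4) (up3 y₃∈N3)) ⟨
          count P? * c2Z⁻
            ≡⟨ double-counting P? (λ y′ → Near? y₃ y′ ×-dec adj? w₄ y′) adj?
                 (λ w ((f , h) , ne) → near-from-both (sym G w₄~y₃) f (ne ∘ ≡.sym) h) columns ⟩
          count (λ y′ → Near? y₃ y′ ×-dec adj? w₄ y′) * (m ∸ 1)
            ≡⟨ cong (_* (m ∸ 1)) (near-from-N4 (sym G w₄~y₃) w₄∈N4) ⟩
          ℓ⁻ * (m ∸ 1) ∎
          where
          open ≡-Reasoning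
          P? : Decidable (λ w → (Adj G y₃ w × N 4 w) × w ≢ w₄)
          P? w = (adj? y₃ w ×-dec N? 4 w) ×-dec ¬? (w Fin.≟ w₄)
          columns : ∀ y′ → Near y₃ y′ × Adj G w₄ y′ → count (λ w → P? w ×-dec adj? w y′) ≡ m ∸ 1
          columns y′ (h , f) = trans
            (count-cong (λ w → P? w ×-dec adj? w y′)
              (λ w → ((adj? y₃ w ×-dec N? 4 w) ×-dec adj? w y′) ×-dec ¬? (w Fin.≟ w₄))
              (λ _ ((p , ne) , g) → (p , g) , ne) (λ _ ((p , g) , ne) → (p , ne) , g))
            (count-remove-∸ (λ w → (adj? y₃ w ×-dec N? 4 w) ×-dec adj? w y′) ((sym G w₄~y₃ , w₄∈N4) , f) (β≡m y₃∈N3 h))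

        ρ<b3 : N 4 w → N 3 y → d w y ≡ 3 → ρ w y < b3
        ρ<b3 {w} {y} h h′ e = ≤∧≢⇒< ρ≤b3 ρ≢b3
          where
          ρ≤b3 : ρ w y ≤ b3
          ρ≤b3 = subst (ρ w y ≤_) (trans (≡.sym (count-split (λ w′ → adj? y w′ ×-dec N? 4 w′) (λ w′ → d w w′ ≟ 2))) (up3 h′)) (m≤m+n (ρ w y) _)
          ℓ⁻≡ : ℓ⁻ ≡ c2Z⁻ + suc b2⁻
          ℓ⁻≡ = suc-injective (trans (≡.sym ℓ≡1+ℓ⁻) (trans ℓ≡c2Z+1+b2⁻ (cong (_+ suc b2⁻) c2Z≡1+c2Z⁻)))
          b3≡ : suc (b3 ∸ 1) ≡ b3
          b3≡ = m+[n∸m]≡n (≤-trans 0<m (<⇒≤ m<b3))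
          m≡ : suc (m ∸ 1) ≡ m
          m≡ = m+[n∸m]≡n 0<m
          ρ≢b3 : ρ w y ≢ b3
          -- Under `ρ≡b3`, `ρ-value` reads b₃ᶻ c₂ᶻ = c₃ʸ m, which is `eq₃`.
          ρ≢b3 ρ≡b3 = extremal-impossible {c2Z⁻} {b2⁻} {m ∸ 1} {b3 ∸ 1}
            (trans (cong (_* c2Z⁻) b3≡) (trans b3*c2Z⁻≡b2⁻*m (cong (b2⁻ *_) (≡.sym m≡))))
            (trans b3⁻*c2Z⁻≡ℓ⁻*m⁻ (cong (_* (m ∸ 1)) ℓ⁻≡))
            (trans (cong₂ _*_ (trans b3≡ (≡.sym ρ≡b3)) (≡.sym c2Z≡1+c2Z⁻)) (trans (ρ-value h h′ e) (cong (c3Y *_) (≡.sym m≡))))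
            (subst (c3Y <_) (trans ℓ≡1+ℓ⁻ (cong suc ℓ⁻≡)) c3Y<ℓ)
            (≤-trans (≤-reflexive (cong suc m≡)) (≤-trans m<b3 (≤-reflexive (≡.sym b3≡))))

        antipode-N4 : N 4 w → ∃ λ w′ → N 4 w′ × d w w′ ≡ 4
        antipode-N4 {w} h =
          let y , h′ , e = N4-at-distance-3 h
              ρ<up = subst (ρ w y <_) (≡.sym (up3 h′)) (ρ<b3 h h′ e)
              w′ , (f , p) , ne = count-< (λ w′ → adj? y w′ ×-dec N? 4 w′) (λ w′ → d w w′ ≟ 2) ρ<up
          in w′ , p , [ id , ⊥-elim ∘ ne ]′ (d-adj-from f e)

        -- The value of `ρ` at one sample pair; cancelling c₂ᶻ in `ρ-value` shows that every pair
        -- gives the same.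
        p : ℕ
        p = ρ w₄ (proj₁ (N4-at-distance-3 w₄∈N4))

        p-value : p * c2Z ≡ c3Y * m
        p-value = let _ , h , e = N4-at-distance-3 w₄∈N4 in ρ-value w₄∈N4 h e

        ρ≡p : N 4 w → N 3 y → d w y ≡ 3 → ρ w y ≡ p
        ρ≡p h h′ e = *-cancelʳ-≡ _ _ c2Z {{subst ℕ.NonZero (≡.sym c2Z≡1+c2Z⁻) _}} (trans (ρ-value h h′ e) (≡.sym p-value))

        S-ecc : S a → ∃ (λ u → S u × d a u ≡ 4) → Ecc G S a 4
        S-ecc {a} sa (v , sv , e) = (λ u su → d a u , d-bounded a u , d⇒S-Dist sa su refl) , v , d⇒S-Dist sa sv e

        S-count-1 : S a → Dist G S a w 1 → Count (λ u → S u × Adj G w u × Dist G S a u 0) 1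
        S-count-1 {a} {w} sa D = count⇒Count (λ u → u Fin.≟ a)
          (λ { _ refl → sa , sym G (d≡1⇒adj (proj₂ (S-Dist⇒d D))) , here sa , λ _ () })
          (λ _ (_ , _ , D′) → ≡.sym (d≡0⇒≡ (proj₂ (S-Dist⇒d D′)))) (count-singleton a)

        arrayY : ∀ a → S a → side a ≡ true → VertexArray G S a b3 4 (1 ∷ m ∷ c3Y ∷ b3 ∷ [])
        arrayY a sa s = valency , S-ecc sa (let v , h , e = antipode-N3 a∈N3 in v , N3⇒S h , e) , cs
          where
          a∈N3 : N 3 a
          a∈N3 = S-true sa s
          valency : Count (λ u → S u × Adj G a u) b3
          valency = count⇒Count (λ w → adj? a w ×-dec N? 4 w)
            (λ _ (f , h) → N4⇒S h , f) (λ _ (sw , f) → f , N3-adj a∈N3 f sw) (up3 a∈N3)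
          cs : ∀ i w → Dist G S a w (suc (toℕ i)) →
            Count (λ u → S u × Adj G w u × Dist G S a u (toℕ i)) (lookup (1 ∷ m ∷ c3Y ∷ b3 ∷ []) i)
          cs 0F w D = S-count-1 sa D
          -- By its side w is in N₃(z), hence near a, and the count is β.
          cs 1F w D = let sw , e = S-Dist⇒d D in count⇒Count (λ u → (adj? a u ×-dec N? 4 u) ×-dec adj? u w)
                (λ _ ((f , h) , g) → N4⇒S h , sym G g , d⇒S-Dist sa (N4⇒S h) (adj⇒d≡1 f))
                (λ _ (su , g , D′) → let f = d≡1⇒adj (proj₂ (S-Dist⇒d D′)) in (f , N3-adj a∈N3 f su) , sym G g)
                (β≡m a∈N3 (S-true sw (side-d 2 s e) , e))
          -- Here w is in N₄(z) and keeps all its neighbours in the subgraph, so c₃ʸ is inherited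
          -- from G.
          cs 2F w D = let sw , e = S-Dist⇒d D in count⇒Count (λ u → adj? w u ×-dec (d a u ≟ 2))
                (λ _ (f , e′) → let su = N3⇒S (N4-adj (S-false sw (side-d 3 s e)) f) in su , f , d⇒S-Dist sa su e′)
                (λ _ (_ , f , D′) → f , proj₂ (S-Dist⇒d D′))
                (countY s 2F e)
          cs 3F w D = let sw , e = S-Dist⇒d D ; w∈N3 = S-true sw (side-d 4 s e) in count⇒Count (λ u → adj? w u ×-dec N? 4 u)
                (λ _ (f , h) → N4⇒S h , f , d⇒S-Dist sa (N4⇒S h) (d≡4⇒adj-d≡3 e f))
                (λ _ (su , f , _) → f , N3-adj w∈N3 f su)
                (up3 w∈N3)

        arrayZ : ∀ a → S a → side a ≡ false → VertexArray G S a ℓ 4 (1 ∷ c2Z ∷ p ∷ ℓ ∷ [])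
        arrayZ a sa s = valency , S-ecc sa (let v , h , e = antipode-N4 a∈N4 in v , N4⇒S h , e) , cs
          where
          a∈N4 : N 4 a
          a∈N4 = S-false sa s
          valency : Count (λ u → S u × Adj G a u) ℓ
          valency = count⇒Count (adj? a) (λ _ f → N3⇒S (N4-adj a∈N4 f) , f) (λ _ → proj₂) (valencyZ s)
          cs : ∀ i w → Dist G S a w (suc (toℕ i)) →
            Count (λ u → S u × Adj G w u × Dist G S a u (toℕ i)) (lookup (1 ∷ c2Z ∷ p ∷ ℓ ∷ []) i)
          cs 0F w D = S-count-1 sa D
          cs 1F w D = let sw , e = S-Dist⇒d D in count⇒Count (λ u → adj? w u ×-dec (d a u ≟ 1))
                (λ _ (f , e′) → let su = N3⇒S (N4-adj (S-false sw (side-d 2 s e)) f) in su , f , d⇒S-Dist sa su e′)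
                (λ _ (_ , f , D′) → f , proj₂ (S-Dist⇒d D′))
                (countZ s 1F e)
          cs 2F w D = let sw , e = S-Dist⇒d D ; w∈N3 = S-true sw (side-d 3 s e) in count⇒Count (λ u → (adj? w u ×-dec N? 4 u) ×-dec (d a u ≟ 2))
                (λ _ ((f , h) , e′) → N4⇒S h , f , d⇒S-Dist sa (N4⇒S h) e′)
                (λ _ (su , f , D′) → (f , N3-adj w∈N3 f su) , proj₂ (S-Dist⇒d D′))
                (ρ≡p a∈N4 w∈N3 e)
          cs 3F w D = let sw , e = S-Dist⇒d D ; w∈N4 = S-false sw (side-d 4 s e) in count⇒Count (adj? w)
                (λ _ f → let su = N3⇒S (N4-adj w∈N4 f) in su , f , d⇒S-Dist sa su (d≡4⇒adj-d≡3 e f))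
                (λ _ (_ , f , _) → f)
                (valencyZ (side4 w∈N4))

        subgraph-distanceBiregular : DistanceBiregular G S side b3 (1 ∷ m ∷ c3Y ∷ b3 ∷ []) ℓ (1 ∷ c2Z ∷ p ∷ ℓ ∷ [])
        subgraph-distanceBiregular = (λ u v _ _ → proj₁ dbr u v tt tt) , arrayY , arrayZ

-- Passage between rational and natural-number identities, and assembly.

open import Data.Rational using (ℚ; 0ℚ; 1ℚ; _+_; _-_; _*_; _<_)

-- `_/_` reduces by a gcd that does not compute on a variable numerator. With denominator 1 the
-- fraction is already in lowest terms, and in this form numerators and order can be read off.
⟦⟧≡mkℚ : ∀ m → ⟦ m ⟧ ≡ ℚ.mkℚ (ℤ.+ m) 0 (Coprime.sym (1-coprimeTo m))
⟦⟧≡mkℚ m = ℚ.normalize-coprime _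

⟦⟧-injective : ∀ {a b} → ⟦ a ⟧ ≡ ⟦ b ⟧ → a ≡ b
⟦⟧-injective {a} {b} e = ℤ.+-injective (cong ℚ.↥_ (trans (≡.sym (⟦⟧≡mkℚ a)) (trans e (⟦⟧≡mkℚ b))))

⟦⟧-cancel-< : ∀ {a b} → ⟦ a ⟧ < ⟦ b ⟧ → a ℕ.< b
⟦⟧-cancel-< {a} {b} lt with subst₂ _<_ (⟦⟧≡mkℚ a) (⟦⟧≡mkℚ b) lt
... | ℚ.*<* h = ℤ.drop‿+<+ (subst₂ ℤ._<_ (ℤ.*-identityʳ (ℤ.+ a)) (ℤ.*-identityʳ (ℤ.+ b)) h)

⟦⟧-homo-+ : ∀ a b → ⟦ a ℕ.+ b ⟧ ≡ ⟦ a ⟧ + ⟦ b ⟧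
⟦⟧-homo-+ a b = ≡.sym (trans (cong₂ _+_ (⟦⟧≡mkℚ a) (⟦⟧≡mkℚ b))
  (cong (ℚ._/ 1) (cong₂ ℤ._+_ (ℤ.*-identityʳ (ℤ.+ a)) (ℤ.*-identityʳ (ℤ.+ b)))))

⟦⟧-homo-* : ∀ a b → ⟦ a ℕ.* b ⟧ ≡ ⟦ a ⟧ * ⟦ b ⟧
⟦⟧-homo-* a b = ≡.sym (trans (cong₂ _*_ (⟦⟧≡mkℚ a) (⟦⟧≡mkℚ b))
  (cong (ℚ._/ 1) (≡.sym (ℤ.pos-* a b))))

⟦⟧-homo-− : ∀ {a} b c → a ≡ b ℕ.+ c → ⟦ a ⟧ - ⟦ b ⟧ ≡ ⟦ c ⟧
⟦⟧-homo-− b c refl = trans (cong (_- ⟦ b ⟧) (⟦⟧-homo-+ b c))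
  (solve 2 (λ x y → x :+ y :- x := y) refl ⟦ b ⟧ ⟦ c ⟧)
  where open +-*-Solver using (solve; _:=_; _:+_; _:*_; _:-_; con)

⟦suc⟧-1 : ∀ a → ⟦ suc a ⟧ - 1ℚ ≡ ⟦ a ⟧
⟦suc⟧-1 a = ⟦⟧-homo-− 1 a refl

div-*-cancel : ∀ p q (q≢0 : q ≢ 0ℚ) → div p q q≢0 * q ≡ p
div-*-cancel p q q≢0 = trans (ℚ.*-assoc p _ q) (trans (cong (p ℚ.*_) (ℚ.*-inverseˡ q)) (ℚ.*-identityʳ p))
  where instance _ = ℚ.≢-nonZero q≢0

div-unique : ∀ x p q (q≢0 : q ≢ 0ℚ) → x * q ≡ p → div p q q≢0 ≡ x
div-unique x p q q≢0 refl = trans (ℚ.*-assoc x q _) (trans (cong (x ℚ.*_) (ℚ.*-inverseʳ q)) (ℚ.*-identityʳ x))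
  where instance _ = ℚ.≢-nonZero q≢0

cross-multiply : ∀ x p q y (q≢0 : q ≢ 0ℚ) → x - div p q q≢0 * y ≡ 0ℚ → x * q ≡ p * y
cross-multiply x p q y q≢0 e = begin
  x * q                                ≡⟨ solve 4 (λ x q d y → x :* q := (x :- d :* y) :* q :+ d :* q :* y) refl x q d y ⟩
  (x - d * y) * q + d * q * y ≡⟨ cong₂ (λ s t → s * q + t * y) e (div-*-cancel p q q≢0) ⟩
  0ℚ * q + p * y                   ≡⟨ solve 3 (λ q p y → con 0ℚ :* q :+ p :* y := p :* y) refl q p y ⟩
  p * y                                ∎
  where
  open ≡-Reasoning
  open +-*-Solver using (solve; _:=_; _:+_; _:*_; _:-_; con)
  d = div p q q≢0

theorem6p1 :
  (G : Graph) (side : Fin (n G) → Bool)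
  (k ℓ c1Y c2Y c3Y c4Y c1Z c2Z c3Z c4Z : ℕ) →
  DistanceBiregular G All side
    k (c1Y ∷ c2Y ∷ c3Y ∷ c4Y ∷ [])
    ℓ (c1Z ∷ c2Z ∷ c3Z ∷ c4Z ∷ []) →
  let b2Z = ⟦ ℓ ⟧ - ⟦ c2Z ⟧
      b3Z = ⟦ k ⟧ - ⟦ c3Z ⟧
      D = b3Z * (⟦ c4Z ⟧ - 1ℚ) + ⟦ c3Z ⟧ * (b2Z - 1ℚ)
  in (c2Y≢0 : ⟦ c2Y ⟧ ≢ 0ℚ) (c2Z≢0 : ⟦ c2Z ⟧ ≢ 0ℚ) (D≢0 : D ≢ 0ℚ) →
  (b2Z - 1ℚ) * (⟦ c4Z ⟧ - 1ℚ) - div D ⟦ c2Y ⟧ c2Y≢0 * (⟦ c2Z ⟧ - 1ℚ) ≡ 0ℚ →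
  let γ3 = div (⟦ c2Y ⟧ * ⟦ c3Z ⟧ * (b2Z - 1ℚ)) D D≢0
  in γ3 < ⟦ c2Y ⟧ →
  ⟦ c2Y ⟧ - γ3 < b3Z →
  ∀ z → side z ≡ false →
  ∃₂ λ (m p : ℕ) →
      ⟦ m ⟧ ≡ ⟦ c2Y ⟧ - γ3
    × ⟦ p ⟧ ≡ div (⟦ m ⟧ * ⟦ c3Y ⟧) ⟦ c2Z ⟧ c2Z≢0
    × DistanceBiregular G (λ u → Dist G All z u 3 ⊎ Dist G All z u 4) side
        (k ∸ c3Z) (1 ∷ m ∷ c3Y ∷ (k ∸ c3Z) ∷ [])
        ℓ (1 ∷ c2Z ∷ p ∷ ℓ ∷ [])
theorem6p1 G side k ℓ c1Y c2Y c3Y c4Y c1Z c2Z c3Z c4Z dbr c2Y≢0 c2Z≢0 D≢0 hyp γ3<c2Y c2Y-γ3<b3Z z side-z =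
  m , p , ⟦m⟧≡ , ⟦p⟧≡ , subgraph-distanceBiregular
  where
  open Distances.Array G side k ℓ c1Y c2Y c3Y c4Y c1Z c2Z c3Z c4Z dbr
  open Local z side-z

  b2Z-1≡ : ⟦ ℓ ⟧ - ⟦ c2Z ⟧ - 1ℚ ≡ ⟦ b2⁻ ⟧
  b2Z-1≡ = trans (cong (_- 1ℚ) (⟦⟧-homo-− c2Z (suc b2⁻) ℓ≡c2Z+1+b2⁻)) (⟦suc⟧-1 b2⁻)

  b3Z≡ : ⟦ k ⟧ - ⟦ c3Z ⟧ ≡ ⟦ b3 ⟧
  b3Z≡ = ⟦⟧-homo-− c3Z b3 k≡c3Z+b3

  c4Z-1≡ : ⟦ c4Z ⟧ - 1ℚ ≡ ⟦ ℓ⁻ ⟧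
  c4Z-1≡ = ⟦⟧-homo-− 1 ℓ⁻ (trans c4Z≡ℓ ℓ≡1+ℓ⁻)

  c2Z-1≡ : ⟦ c2Z ⟧ - 1ℚ ≡ ⟦ c2Z⁻ ⟧
  c2Z-1≡ = ⟦⟧-homo-− 1 c2Z⁻ c2Z≡1+c2Z⁻

  D : ℚ
  D = (⟦ k ⟧ - ⟦ c3Z ⟧) * (⟦ c4Z ⟧ - 1ℚ) + ⟦ c3Z ⟧ * (⟦ ℓ ⟧ - ⟦ c2Z ⟧ - 1ℚ)

  D≡ : D ≡ ⟦ A ℕ.+ B ⟧
  D≡ = begin
    D                                      ≡⟨ cong₂ _+_ (cong₂ _*_ b3Z≡ c4Z-1≡) (cong (⟦ c3Z ⟧ *_) b2Z-1≡) ⟩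
    ⟦ b3 ⟧ * ⟦ ℓ⁻ ⟧ + ⟦ c3Z ⟧ * ⟦ b2⁻ ⟧    ≡⟨ cong₂ _+_ (⟦⟧-homo-* b3 ℓ⁻) (⟦⟧-homo-* c3Z b2⁻) ⟨
    ⟦ B ⟧ + ⟦ A ⟧                          ≡⟨ ⟦⟧-homo-+ B A ⟨
    ⟦ B ℕ.+ A ⟧                            ≡⟨ cong ⟦_⟧ (ℕ.+-comm B A) ⟩
    ⟦ A ℕ.+ B ⟧                            ∎
    where open ≡-Reasoning

  equality : b2⁻ ℕ.* ℓ⁻ ℕ.* c2Y ≡ (A ℕ.+ B) ℕ.* c2Z⁻
  equality = ⟦⟧-injective (begin
    ⟦ b2⁻ ℕ.* ℓ⁻ ℕ.* c2Y ⟧                              ≡⟨ ⟦⟧-homo-* (b2⁻ ℕ.* ℓ⁻) c2Y ⟩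
    ⟦ b2⁻ ℕ.* ℓ⁻ ⟧ * ⟦ c2Y ⟧                            ≡⟨ cong (_* ⟦ c2Y ⟧) (⟦⟧-homo-* b2⁻ ℓ⁻) ⟩
    ⟦ b2⁻ ⟧ * ⟦ ℓ⁻ ⟧ * ⟦ c2Y ⟧                          ≡⟨ cong (_* ⟦ c2Y ⟧) (cong₂ _*_ b2Z-1≡ c4Z-1≡) ⟨
    (⟦ ℓ ⟧ - ⟦ c2Z ⟧ - 1ℚ) * (⟦ c4Z ⟧ - 1ℚ) * ⟦ c2Y ⟧   ≡⟨ cross-multiply ((⟦ ℓ ⟧ - ⟦ c2Z ⟧ - 1ℚ) * (⟦ c4Z ⟧ - 1ℚ)) D ⟦ c2Y ⟧ (⟦ c2Z ⟧ - 1ℚ) c2Y≢0 hyp ⟩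
    D * (⟦ c2Z ⟧ - 1ℚ)                                  ≡⟨ cong₂ _*_ D≡ c2Z-1≡ ⟩
    ⟦ A ℕ.+ B ⟧ * ⟦ c2Z⁻ ⟧                              ≡⟨ ⟦⟧-homo-* (A ℕ.+ B) c2Z⁻ ⟨
    ⟦ (A ℕ.+ B) ℕ.* c2Z⁻ ⟧                              ∎)
    where open ≡-Reasoning

  0<A+B : 0 ℕ.< A ℕ.+ B
  0<A+B = ℕ.n≢0⇒n>0 (λ e → D≢0 (trans D≡ (cong ⟦_⟧ e)))

  y′ : Fin (n G)
  y′ = proj₁ (near-exists 0<A+B y₃∈N3)

  y′-near : Near y₃ y′
  y′-near = proj₂ (near-exists 0<A+B y₃∈N3)

  -- One near pair fixes both constants: g is γ₃ and m is c₂ʸ - γ₃, so both are natural numbers.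
  g m : ℕ
  g = α y₃ y′
  m = β y₃ y′

  g+m≡c2Y : g ℕ.+ m ≡ c2Y
  g+m≡c2Y = α+β≡c2Y y₃∈N3 y′-near

  γ3 : ℚ
  γ3 = div (⟦ c2Y ⟧ * ⟦ c3Z ⟧ * (⟦ ℓ ⟧ - ⟦ c2Z ⟧ - 1ℚ)) D D≢0

  γ3≡⟦g⟧ : γ3 ≡ ⟦ g ⟧
  γ3≡⟦g⟧ = div-unique ⟦ g ⟧ _ D D≢0 (begin
    ⟦ g ⟧ * D                                           ≡⟨ cong (⟦ g ⟧ *_) D≡ ⟩
    ⟦ g ⟧ * ⟦ A ℕ.+ B ⟧                                 ≡⟨ ⟦⟧-homo-* g (A ℕ.+ B) ⟨
    ⟦ g ℕ.* (A ℕ.+ B) ⟧                                 ≡⟨ cong ⟦_⟧ (trans (ℕ.*-comm g (A ℕ.+ B)) (α-value equality y₃∈N3 y′-near)) ⟩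
    ⟦ A ℕ.* c2Y ⟧                                       ≡⟨ cong ⟦_⟧ (rearrange c3Z b2⁻ c2Y) ⟩
    ⟦ c2Y ℕ.* c3Z ℕ.* b2⁻ ⟧                             ≡⟨ ⟦⟧-homo-* (c2Y ℕ.* c3Z) b2⁻ ⟩
    ⟦ c2Y ℕ.* c3Z ⟧ * ⟦ b2⁻ ⟧                           ≡⟨ cong₂ _*_ (⟦⟧-homo-* c2Y c3Z) (≡.sym b2Z-1≡) ⟩
    ⟦ c2Y ⟧ * ⟦ c3Z ⟧ * (⟦ ℓ ⟧ - ⟦ c2Z ⟧ - 1ℚ)          ∎)
    where
    open ≡-Reasoning
    rearrange : ∀ a b c → a ℕ.* b ℕ.* c ≡ c ℕ.* a ℕ.* b
    rearrange = solve-∀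

  ⟦m⟧≡ : ⟦ m ⟧ ≡ ⟦ c2Y ⟧ - γ3
  ⟦m⟧≡ = ≡.sym (trans (cong (⟦ c2Y ⟧ -_) γ3≡⟦g⟧) (⟦⟧-homo-− g m (≡.sym g+m≡c2Y)))

  -- With γ₃ = g and c₂ʸ = g + m, the hypothesis γ₃ < c₂ʸ says g + 0 < g + m.
  0<m : 0 ℕ.< m
  0<m = ℕ.+-cancelˡ-< g 0 m (subst₂ ℕ._<_ (≡.sym (ℕ.+-identityʳ g)) (≡.sym g+m≡c2Y)
    (⟦⟧-cancel-< (subst (_< ⟦ c2Y ⟧) γ3≡⟦g⟧ γ3<c2Y)))

  m<b3 : m ℕ.< b3
  m<b3 = ⟦⟧-cancel-< (subst₂ _<_ (≡.sym ⟦m⟧≡) b3Z≡ c2Y-γ3<b3Z)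

  open Subgraph m 0<m m<b3 (β-constant equality 0<A+B y₃∈N3 y′-near) (near-exists 0<A+B)

  ⟦p⟧≡ : ⟦ p ⟧ ≡ div (⟦ m ⟧ * ⟦ c3Y ⟧) ⟦ c2Z ⟧ c2Z≢0
  ⟦p⟧≡ = ≡.sym (div-unique ⟦ p ⟧ _ ⟦ c2Z ⟧ c2Z≢0 (begin
    ⟦ p ⟧ * ⟦ c2Z ⟧     ≡⟨ ⟦⟧-homo-* p c2Z ⟨
    ⟦ p ℕ.* c2Z ⟧       ≡⟨ cong ⟦_⟧ (trans p-value (ℕ.*-comm c3Y m)) ⟩
    ⟦ m ℕ.* c3Y ⟧       ≡⟨ ⟦⟧-homo-* m c3Y ⟩
    ⟦ m ⟧ * ⟦ c3Y ⟧     ∎))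
    where open ≡-Reasoning
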